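{- Let $\chi$ denote the chromatic number of the Euclidean plane $\mathbb{R}^2$. Then $\chi \ge 5$. Equivalently, for every function $c:\mathbb{R}^2\to\{1,2,3,4\}$ there exist points $x,y\in\mathbb{R}^2$ with Euclidean distance $\|x-y\|=1$ and $c(x)=c(y)$.
   Context: The chromatic number $\chi$ of the plane is the smallest number $k$ of colors for which there is a coloring $c:\mathbb{R}^2\to\{1,\dots,k\}$ of all points of the Euclidean plane such that any two points at Euclidean distance exactly $1$ receive different colors (such a coloring is called proper). No regularity is required of the color classes. -}

module Defs where

open import Data.Fin.Base using (Fin)
open import Data.Integer.Base as ℤ using (+_)
import Data.Integer.Properties as ℤ
open import Data.Nat.Base as ℕ using (ℕ; zero; suc)
import Data.Nat.Properties as ℕ
import Data.Nat.Solver as ℕSolver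
open import Data.Product.Base using (∃; _×_; _,_)
open import Data.Product.Relation.Binary.Pointwise.NonDependent using (×-setoid)
open import Data.Rational.Base as ℚ
  using (ℚ; 0ℚ; 1ℚ; ½; _/_; ↥_; ↧ₙ_; ∣_∣; _<_; _≤_; toℚᵘ; NonNegative)
open import Data.Rational.Properties
import Data.Rational.Solver as ℚSolver
import Data.Rational.Unnormalised.Base as ℚᵘ
import Data.Rational.Unnormalised.Properties as ℚᵘ
open import Data.Sum.Base using (inj₁; inj₂)
open import Function.Bundles using (Func)
open import Level using (0ℓ)
open import Relation.Binary.Bundles using (Setoid)
open import Relation.Binary.PropositionalEquality
  using (_≡_; _≢_; refl; sym; trans; cong; subst; subst₂; setoid)
open import Relation.Nullary using (yes; no; contradiction)

IsCauchy : (ℕ → ℚ) → Set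
IsCauchy x = ∀ ε → 0ℚ < ε →
  ∃ λ N → ∀ m n → N ℕ.≤ m → N ℕ.≤ n → ∣ x m ℚ.- x n ∣ < ε

-- Real numbers as Cauchy sequences of rationals; the quotient by null
-- sequences is expressed by the setoid equality _≈_.
record ℝ : Set where
  constructor mkℝ
  field
    seq    : ℕ → ℚ
    cauchy : IsCauchy seq
open ℝ public

infix 4 _≈_ _≤ℝ_

_≈_ : ℝ → ℝ → Set
x ≈ y = ∀ ε → 0ℚ < ε →
  ∃ λ N → ∀ n → N ℕ.≤ n → ∣ seq x n ℚ.- seq y n ∣ < ε

_≤ℝ_ : ℝ → ℝ → Set
x ≤ℝ y = ∀ ε → 0ℚ < ε →
  ∃ λ N → ∀ n → N ℕ.≤ n → seq x n ≤ seq y n ℚ.+ ε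

module _ where
  open ℚSolver.+-*-Solver

  half+half : ∀ ε → ½ ℚ.* ε ℚ.+ ½ ℚ.* ε ≡ ε
  half+half = solve 1 (λ e → con ½ :* e :+ con ½ :* e := e) refl

  +-interchange-neg : ∀ a b c d →
    (a ℚ.+ b) ℚ.- (c ℚ.+ d) ≡ (a ℚ.- c) ℚ.+ (b ℚ.- d)
  +-interchange-neg =
    solve 4 (λ a b c d → (a :+ b) :- (c :+ d) := (a :- c) :+ (b :- d)) refl

  neg-diff : ∀ a b → ℚ.- a ℚ.- ℚ.- b ≡ ℚ.- (a ℚ.- b)
  neg-diff = solve 2 (λ a b → :- a :- :- b := :- (a :- b)) refl

  flip-diff : ∀ a b → ℚ.- (a ℚ.- b) ≡ b ℚ.- a
  flip-diff = solve 2 (λ a b → :- (a :- b) := b :- a) refl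

  telescope : ∀ a b c → a ℚ.- c ≡ (a ℚ.- b) ℚ.+ (b ℚ.- c)
  telescope = solve 3 (λ a b c → a :- c := (a :- b) :+ (b :- c)) refl

  *-diff : ∀ a b c d →
    a ℚ.* b ℚ.- c ℚ.* d ≡ a ℚ.* (b ℚ.- d) ℚ.+ d ℚ.* (a ℚ.- c)
  *-diff =
    solve 4 (λ a b c d → a :* b :- c :* d := a :* (b :- d) :+ d :* (a :- c)) refl

  diff+ : ∀ a b → (a ℚ.- b) ℚ.+ b ≡ a
  diff+ = solve 2 (λ a b → (a :- b) :+ b := a) refl

  scale-cancel : ∀ b e i → b ℚ.* (e ℚ.* i) ≡ e ℚ.* (b ℚ.* i)
  scale-cancel = solve 3 (λ b e i → b :* (e :* i) := e :* (b :* i)) refl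

  square-shift : ∀ t h →
    (t ℚ.+ (h ℚ.+ h)) ℚ.* (t ℚ.+ (h ℚ.+ h)) ≡
    (t ℚ.+ h) ℚ.* (t ℚ.+ h) ℚ.+ h ℚ.* h ℚ.+ ((t ℚ.+ h) ℚ.* h ℚ.+ (t ℚ.+ h) ℚ.* h)
  square-shift = solve 2 (λ t h →
    (t :+ (h :+ h)) :* (t :+ (h :+ h)) :=
    (t :+ h) :* (t :+ h) :+ h :* h :+ ((t :+ h) :* h :+ (t :+ h) :* h)) refl

  square-expand : ∀ s d → (s ℚ.+ d) ℚ.* (s ℚ.+ d) ≡ s ℚ.* s ℚ.+ (s ℚ.+ s ℚ.+ d) ℚ.* d
  square-expand = solve 2 (λ s d → (s :+ d) :* (s :+ d) := s :* s :+ (s :+ s :+ d) :* d) refl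

  +-swap-diff : ∀ a b → (a ℚ.+ b) ℚ.- a ≡ b
  +-swap-diff = solve 2 (λ a b → (a :+ b) :- a := b) refl

half-pos : ∀ {ε} → 0ℚ < ε → 0ℚ < ½ ℚ.* ε
half-pos {ε} ε>0 =
  positive⁻¹ (½ ℚ.* ε) {{pos*pos⇒pos ½ ε {{ℚ.positive ε>0}}}}

-- A rational δ > 0 with b · δ ≡ ε.
shrink : ∀ b ε → 0ℚ < b → 0ℚ < ε → ∃ λ δ → 0ℚ < δ × b ℚ.* δ ≡ ε
shrink b ε b>0 ε>0 =
  ε ℚ.* b⁻¹
  , positive⁻¹ _ {{pos*pos⇒pos ε {{ℚ.positive ε>0}} b⁻¹ {{1/pos⇒pos b {{ℚ.positive b>0}}}}}}
  , trans (scale-cancel b ε b⁻¹)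
      (trans (cong (ε ℚ.*_) (*-inverseʳ b {{nz}})) (*-identityʳ ε))
  where
  nz = pos⇒nonZero b {{ℚ.positive b>0}}
  b⁻¹ = (ℚ.1/ b) {{nz}}

∣-∣-sym : ∀ a b → ∣ a ℚ.- b ∣ ≡ ∣ b ℚ.- a ∣
∣-∣-sym a b = trans (sym (∣-p∣≡∣p∣ (a ℚ.- b))) (cong ∣_∣ (flip-diff a b))

p≤∣p∣ : ∀ p → p ≤ ∣ p ∣
p≤∣p∣ p with ≤-total 0ℚ p
... | inj₁ 0≤p = ≤-reflexive (sym (0≤p⇒∣p∣≡p 0≤p))
... | inj₂ p≤0 = ≤-trans p≤0 (0≤∣p∣ p)

∣∣<-intro : ∀ {a b ε} → a < b ℚ.+ ε → b < a ℚ.+ ε → ∣ a ℚ.- b ∣ < ε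
∣∣<-intro {a} {b} {ε} a<b+ε b<a+ε with ∣p∣≡p∨∣p∣≡-p (a ℚ.- b)
... | inj₁ eq = subst₂ _<_ (sym eq) (+-swap-diff b ε) (+-monoˡ-< (ℚ.- b) a<b+ε)
... | inj₂ eq = subst₂ _<_ (sym (trans eq (flip-diff a b))) (+-swap-diff a ε)
                  (+-monoˡ-< (ℚ.- a) b<a+ε)

∣∣<⇒< : ∀ {a b ε} → ∣ a ℚ.- b ∣ < ε → a < ε ℚ.+ b
∣∣<⇒< {a} {b} {ε} lt = subst (_< ε ℚ.+ b) (diff+ a b)
  (+-monoˡ-< b (≤-<-trans (p≤∣p∣ (a ℚ.- b)) lt))

∣a+b∣<ε : ∀ {ε} a b → ∣ a ∣ < ½ ℚ.* ε → ∣ b ∣ < ½ ℚ.* ε → ∣ a ℚ.+ b ∣ < ε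
∣a+b∣<ε {ε} a b la lb = ≤-<-trans (∣p+q∣≤∣p∣+∣q∣ a b)
  (subst (∣ a ∣ ℚ.+ ∣ b ∣ <_) (half+half ε) (+-mono-< la lb))

≈-refl : ∀ {x} → x ≈ x
≈-refl {x} ε ε>0 with cauchy x ε ε>0
... | N , c = N , λ n N≤n → c n n N≤n N≤n

≈-sym : ∀ {x y} → x ≈ y → y ≈ x
≈-sym {x} {y} x≈y ε ε>0 with x≈y ε ε>0
... | N , c = N , λ n N≤n → subst (_< ε) (∣-∣-sym (seq x n) (seq y n)) (c n N≤n)

≈-trans : ∀ {x y z} → x ≈ y → y ≈ z → x ≈ z
≈-trans {x} {y} {z} x≈y y≈z ε ε>0
  with x≈y (½ ℚ.* ε) (half-pos ε>0) | y≈z (½ ℚ.* ε) (half-pos ε>0)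
... | M , c | N , d = M ℕ.⊔ N , λ n le →
  subst (λ t → ∣ t ∣ < ε) (sym (telescope (seq x n) (seq y n) (seq z n)))
    (∣a+b∣<ε (seq x n ℚ.- seq y n) (seq y n ℚ.- seq z n)
       (c n (ℕ.≤-trans (ℕ.m≤m⊔n M N) le)) (d n (ℕ.≤-trans (ℕ.m≤n⊔m M N) le)))

ℝ-setoid : Setoid 0ℓ 0ℓ
ℝ-setoid = record
  { Carrier = ℝ
  ; _≈_ = _≈_
  ; isEquivalence = record
    { refl  = λ {x} → ≈-refl {x}
    ; sym   = λ {x} {y} → ≈-sym {x} {y}
    ; trans = λ {x} {y} {z} → ≈-trans {x} {y} {z}
    }
  }

fromℚ : ℚ → ℝ
fromℚ q = mkℝ (λ _ → q) λ ε ε>0 → 0 , λ _ _ _ _ →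
  subst (λ t → ∣ t ∣ < ε) (sym (+-inverseʳ q)) ε>0

0ℝ 1ℝ : ℝ
0ℝ = fromℚ 0ℚ
1ℝ = fromℚ 1ℚ

infixl 6 _+_ _-_
infixl 7 _*_
infix  8 -_

_+_ : ℝ → ℝ → ℝ
x + y = mkℝ (λ n → seq x n ℚ.+ seq y n) isC
  where
  isC : IsCauchy (λ n → seq x n ℚ.+ seq y n)
  isC ε ε>0 with cauchy x (½ ℚ.* ε) (half-pos ε>0) | cauchy y (½ ℚ.* ε) (half-pos ε>0)
  ... | M , c | N , d = M ℕ.⊔ N , λ m n lm ln →
    subst (λ t → ∣ t ∣ < ε)
      (sym (+-interchange-neg (seq x m) (seq y m) (seq x n) (seq y n)))
      (∣a+b∣<ε (seq x m ℚ.- seq x n) (seq y m ℚ.- seq y n)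
        (c m n (ℕ.≤-trans (ℕ.m≤m⊔n M N) lm) (ℕ.≤-trans (ℕ.m≤m⊔n M N) ln))
        (d m n (ℕ.≤-trans (ℕ.m≤n⊔m M N) lm) (ℕ.≤-trans (ℕ.m≤n⊔m M N) ln)))

-_ : ℝ → ℝ
- x = mkℝ (λ n → ℚ.- seq x n) isC
  where
  isC : IsCauchy (λ n → ℚ.- seq x n)
  isC ε ε>0 with cauchy x ε ε>0
  ... | N , c = N , λ m n lm ln →
    subst (_< ε)
      (sym (trans (cong ∣_∣ (neg-diff (seq x m) (seq x n)))
                  (∣-p∣≡∣p∣ (seq x m ℚ.- seq x n))))
      (c m n lm ln)

_-_ : ℝ → ℝ → ℝ
x - y = x + (- y)

eventually-bounded : ∀ x → ∃ λ B → 0ℚ < B × ∃ λ N → ∀ n → N ℕ.≤ n → ∣ seq x n ∣ ≤ B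
eventually-bounded x with cauchy x 1ℚ (positive⁻¹ 1ℚ)
... | N , c = 1ℚ ℚ.+ ∣ seq x N ∣
  , <-≤-trans (positive⁻¹ 1ℚ)
      (subst (_≤ 1ℚ ℚ.+ ∣ seq x N ∣) (+-identityʳ 1ℚ) (+-monoʳ-≤ 1ℚ (0≤∣p∣ (seq x N))))
  , N , λ n N≤n →
      subst (λ t → ∣ t ∣ ≤ 1ℚ ℚ.+ ∣ seq x N ∣) (diff+ (seq x n) (seq x N))
        (≤-trans (∣p+q∣≤∣p∣+∣q∣ (seq x n ℚ.- seq x N) (seq x N))
          (+-monoˡ-≤ ∣ seq x N ∣ (<⇒≤ (c n N N≤n ℕ.≤-refl))))

∣*∣<-bound : ∀ {B δ} a b → 0ℚ < B → ∣ a ∣ ≤ B → ∣ b ∣ < δ → ∣ a ℚ.* b ∣ < B ℚ.* δ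
∣*∣<-bound {B} {δ} a b B>0 a≤B b<δ = subst (_< B ℚ.* δ) (sym (∣p*q∣≡∣p∣*∣q∣ a b))
  (≤-<-trans
    (*-monoʳ-≤-nonNeg ∣ b ∣ {{∣-∣-nonNeg b}} a≤B)
    (*-monoʳ-<-pos B {{ℚ.positive B>0}} b<δ))

∣ab+cd∣<ε : ∀ {A B α β ε} a b c d → 0ℚ < A → 0ℚ < B →
  A ℚ.* α ≡ ½ ℚ.* ε → B ℚ.* β ≡ ½ ℚ.* ε →
  ∣ a ∣ ≤ A → ∣ b ∣ < α → ∣ c ∣ ≤ B → ∣ d ∣ < β →
  ∣ a ℚ.* b ℚ.+ c ℚ.* d ∣ < ε
∣ab+cd∣<ε a b c d A>0 B>0 Aα Bβ la lb lc ld =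
  ∣a+b∣<ε (a ℚ.* b) (c ℚ.* d)
    (subst (∣ a ℚ.* b ∣ <_) Aα (∣*∣<-bound a b A>0 la lb))
    (subst (∣ c ℚ.* d ∣ <_) Bβ (∣*∣<-bound c d B>0 lc ld))

_*_ : ℝ → ℝ → ℝ
x * y = mkℝ (λ n → seq x n ℚ.* seq y n) isC
  where
  isC : IsCauchy (λ n → seq x n ℚ.* seq y n)
  isC ε ε>0 =
    let A , A>0 , K , bx = eventually-bounded x
        B , B>0 , L , by = eventually-bounded y
        α , α>0 , Aα = shrink A (½ ℚ.* ε) A>0 (half-pos ε>0)
        β , β>0 , Bβ = shrink B (½ ℚ.* ε) B>0 (half-pos ε>0)
        M , c = cauchy y α α>0
        N , d = cauchy x β β>0
        KL≤ : ∀ {k} → (K ℕ.⊔ L) ℕ.⊔ (M ℕ.⊔ N) ℕ.≤ k → K ℕ.⊔ L ℕ.≤ k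
        KL≤ = ℕ.m⊔n≤o⇒m≤o (K ℕ.⊔ L) (M ℕ.⊔ N)
        MN≤ : ∀ {k} → (K ℕ.⊔ L) ℕ.⊔ (M ℕ.⊔ N) ℕ.≤ k → M ℕ.⊔ N ℕ.≤ k
        MN≤ = ℕ.m⊔n≤o⇒n≤o (K ℕ.⊔ L) (M ℕ.⊔ N)
    in (K ℕ.⊔ L) ℕ.⊔ (M ℕ.⊔ N) , λ m n lm ln →
      subst (λ t → ∣ t ∣ < ε) (sym (*-diff (seq x m) (seq y m) (seq x n) (seq y n)))
        (∣ab+cd∣<ε (seq x m) (seq y m ℚ.- seq y n) (seq y n) (seq x m ℚ.- seq x n)
          A>0 B>0 Aα Bβ
          (bx m (ℕ.m⊔n≤o⇒m≤o K L (KL≤ lm)))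
          (c m n (ℕ.m⊔n≤o⇒m≤o M N (MN≤ lm)) (ℕ.m⊔n≤o⇒m≤o M N (MN≤ ln)))
          (by n (ℕ.m⊔n≤o⇒n≤o K L (KL≤ ln)))
          (d m n (ℕ.m⊔n≤o⇒n≤o M N (MN≤ lm)) (ℕ.m⊔n≤o⇒n≤o M N (MN≤ ln))))

-- ⌊√n⌋
isqrt : ℕ → ℕ
isqrt zero = zero
isqrt (suc n) with suc (isqrt n) ℕ.* suc (isqrt n) ℕ.≤? suc n
... | yes _ = suc (isqrt n)
... | no  _ = isqrt n

isqrt-lower : ∀ n → isqrt n ℕ.* isqrt n ℕ.≤ n
isqrt-lower zero = ℕ.z≤n
isqrt-lower (suc n) with suc (isqrt n) ℕ.* suc (isqrt n) ℕ.≤? suc n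
... | yes le = le
... | no  _  = ℕ.m≤n⇒m≤1+n (isqrt-lower n)

isqrt-upper : ∀ n → n ℕ.< suc (isqrt n) ℕ.* suc (isqrt n)
isqrt-upper zero = ℕ.s≤s ℕ.z≤n
isqrt-upper (suc n) with suc (isqrt n) ℕ.* suc (isqrt n) ℕ.≤? suc n
... | yes le = ℕ.≤-<-trans (isqrt-upper n) 
  (ℕ.*-mono-< {j} {suc j} {j} {suc j} (ℕ.n<1+n j) (ℕ.n<1+n j))
  where j = suc (isqrt n)
... | no ¬le = ℕ.≰⇒> ¬le

module _ (p : ℚ) .{{_ : NonNegative p}} (r d-1 : ℕ) where
  private
    a = ℤ.∣ ↥ p ∣
    b = ↧ₙ p
    d = suc d-1
    s = + r / d

    toℚᵘ-s² : toℚᵘ (s ℚ.* s) ℚᵘ.≃ ℚᵘ.mkℚᵘ (+ r) d-1 ℚᵘ.* ℚᵘ.mkℚᵘ (+ r) d-1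
    toℚᵘ-s² = ℚᵘ.≃-trans (toℚᵘ-homo-* s s) (ℚᵘ.*-cong s≃ s≃)
      where s≃ = toℚᵘ-fromℚᵘ (ℚᵘ.mkℚᵘ (+ r) d-1)

    ↥p≡a : ↥ p ≡ + a
    ↥p≡a = nonNeg-↥ p
      where
      nonNeg-↥ : ∀ q → .{{NonNegative q}} → ↥ q ≡ + ℤ.∣ ↥ q ∣
      nonNeg-↥ (ℚ.mkℚ (+ _) _ _) = refl

    lhs : + (r ℕ.* r ℕ.* b) ≡ (+ r ℤ.* + r) ℤ.* ℚ.↧ p
    lhs = trans (ℤ.pos-* (r ℕ.* r) b) (cong (ℤ._* ℚ.↧ p) (ℤ.pos-* r r))

    rhs : + (a ℕ.* (d ℕ.* d)) ≡ ↥ p ℤ.* + (d ℕ.* d)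
    rhs = trans (ℤ.pos-* a (d ℕ.* d)) (cong (ℤ._* + (d ℕ.* d)) (sym ↥p≡a))

    toℚᵘ-p : ℚᵘ.mkℚᵘ (↥ p) (ℚ.denominator-1 p) ≡ toℚᵘ p
    toℚᵘ-p = eta p
      where
      eta : ∀ q → ℚᵘ.mkℚᵘ (↥ q) (ℚ.denominator-1 q) ≡ toℚᵘ q
      eta (ℚ.mkℚ _ _ _) = refl

  frac²≤ : r ℕ.* r ℕ.* b ℕ.≤ a ℕ.* (d ℕ.* d) → s ℚ.* s ≤ p
  frac²≤ le = toℚᵘ-cancel-≤ (ℚᵘ.≤-respˡ-≃ (ℚᵘ.≃-sym toℚᵘ-s²)
    (subst (_ ℚᵘ.≤_) toℚᵘ-p (ℚᵘ.*≤* (subst₂ ℤ._≤_ lhs rhs (ℤ.+≤+ le)))))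

  <frac² : a ℕ.* (d ℕ.* d) ℕ.< r ℕ.* r ℕ.* b → p < s ℚ.* s
  <frac² lt = toℚᵘ-cancel-< (ℚᵘ.<-respʳ-≃ (ℚᵘ.≃-sym toℚᵘ-s²)
    (subst (ℚᵘ._< _) toℚᵘ-p (ℚᵘ.*<* (subst₂ ℤ._<_ rhs lhs (ℤ.+<+ lt)))))

-- For q = a / b ≥ 0 in lowest terms, √q = √(a b) / b, and √q is approximated
-- from below with error less than 1 / (b (n + 1)) by
-- ⌊ √(a b (n + 1)²) ⌋ / (b (n + 1)).  Negative q are replaced by 0.
sqrtApprox : ℚ → ℕ → ℚ
sqrtApprox q n =
  + isqrt (ℤ.∣ ↥ p ∣ ℕ.* ↧ₙ p ℕ.* (suc n ℕ.* suc n)) / (↧ₙ p ℕ.* suc n)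
  where p = q ℚ.⊔ 0ℚ

unit : ℕ → ℚ
unit n = + 1 / suc n

module _ where
  open ℕSolver.+-*-Solver

  regroup : ∀ a b m → a ℕ.* b ℕ.* (m ℕ.* m) ℕ.* b ≡ a ℕ.* ((b ℕ.* m) ℕ.* (b ℕ.* m))
  regroup = solve 3 (λ a b m → a :* b :* (m :* m) :* b := a :* ((b :* m) :* (b :* m))) refl

⊔0-nonNeg : ∀ q → NonNegative (q ℚ.⊔ 0ℚ)
⊔0-nonNeg q = ℚ.nonNegative (p≤q⊔p q 0ℚ)

frac-nonNeg : ∀ r d-1 → 0ℚ ≤ + r / suc d-1
frac-nonNeg r d-1 = nonNegative⁻¹ (+ r / suc d-1) {{normalize-nonNeg r (suc d-1)}}

sqrtApprox-nonNeg : ∀ q n → 0ℚ ≤ sqrtApprox q n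
sqrtApprox-nonNeg q n =
  frac-nonNeg (isqrt (ℤ.∣ ↥ p ∣ ℕ.* ↧ₙ p ℕ.* (suc n ℕ.* suc n)))
    (n ℕ.+ ℚ.denominator-1 p ℕ.* suc n)
  where p = q ℚ.⊔ 0ℚ

sqrtApprox-lower : ∀ q n → sqrtApprox q n ℚ.* sqrtApprox q n ≤ q ℚ.⊔ 0ℚ
sqrtApprox-lower q n =
  frac²≤ p {{⊔0-nonNeg q}} (isqrt k) (n ℕ.+ ℚ.denominator-1 p ℕ.* suc n)
    (subst (isqrt k ℕ.* isqrt k ℕ.* ↧ₙ p ℕ.≤_) (regroup ℤ.∣ ↥ p ∣ (↧ₙ p) (suc n))
      (ℕ.*-monoˡ-≤ (↧ₙ p) (isqrt-lower k)))
  where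
  p = q ℚ.⊔ 0ℚ
  k = ℤ.∣ ↥ p ∣ ℕ.* ↧ₙ p ℕ.* (suc n ℕ.* suc n)

frac-suc : ∀ r d-1 → + suc r / suc d-1 ≡ + r / suc d-1 ℚ.+ unit d-1
frac-suc r d-1 = toℚᵘ-injective
  (ℚᵘ.≃-trans (toℚᵘ-fromℚᵘ (ℚᵘ.mkℚᵘ (+ suc r) d-1))
  (ℚᵘ.≃-trans (ℚᵘ.*≡* eq)
  (ℚᵘ.≃-trans (ℚᵘ.≃-sym (ℚᵘ.+-cong (toℚᵘ-fromℚᵘ (ℚᵘ.mkℚᵘ (+ r) d-1))
                                   (toℚᵘ-fromℚᵘ (ℚᵘ.mkℚᵘ (+ 1) d-1))))
  (ℚᵘ.≃-sym (toℚᵘ-homo-+ (+ r / suc d-1) (unit d-1))))))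
  where
  d = suc d-1
  eq : + suc r ℤ.* + (d ℕ.* d) ≡ (+ r ℤ.* + d ℤ.+ + 1 ℤ.* + d) ℤ.* + d
  eq = trans (cong (+ suc r ℤ.*_) (ℤ.pos-* d d))
      (trans (sym (ℤ.*-assoc (+ suc r) (+ d) (+ d)))
      (cong (ℤ._* + d)
        (trans (cong (ℤ._* + d) (cong +_ (sym (ℕ.+-comm r 1))))
               (ℤ.*-distribʳ-+ (+ d) (+ r) (+ 1)))))

unit-antitone : ∀ {m n} → m ℕ.≤ n → unit n ≤ unit m
unit-antitone {m} {n} m≤n = toℚᵘ-cancel-≤
  (ℚᵘ.≤-respʳ-≃ (ℚᵘ.≃-sym (toℚᵘ-fromℚᵘ (ℚᵘ.mkℚᵘ (+ 1) m)))
  (ℚᵘ.≤-respˡ-≃ (ℚᵘ.≃-sym (toℚᵘ-fromℚᵘ (ℚᵘ.mkℚᵘ (+ 1) n)))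
    (ℚᵘ.*≤* (subst₂ ℤ._≤_ (sym (ℤ.*-identityˡ (+ suc m))) (sym (ℤ.*-identityˡ (+ suc n)))
      (ℤ.+≤+ (ℕ.s≤s m≤n))))))

unit-nonNeg : ∀ n → 0ℚ ≤ unit n
unit-nonNeg n = frac-nonNeg 1 n

archimedean : ∀ ε → 0ℚ < ε → ∃ λ N → unit N ≤ ε
archimedean (ℚ.mkℚ (+ zero) d-1 _) ε>0 = contradiction refl (ℤ.<⇒≢ (drop-*<* ε>0))
archimedean (ℚ.mkℚ (+ suc a) d-1 _) _ = d-1 , toℚᵘ-cancel-≤
  (ℚᵘ.≤-respˡ-≃ (ℚᵘ.≃-sym (toℚᵘ-fromℚᵘ (ℚᵘ.mkℚᵘ (+ 1) d-1)))
    (ℚᵘ.*≤* (ℤ.*-monoʳ-≤-nonNeg (+ suc d-1) {+ 1} {+ suc a} (ℤ.+≤+ (ℕ.s≤s ℕ.z≤n)))))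
archimedean (ℚ.mkℚ ℤ.-[1+ a ] d-1 _) ε>0 with drop-*<* ε>0
... | ()

square-mono : ∀ {a b} → 0ℚ ≤ a → a ≤ b → a ℚ.* a ≤ b ℚ.* b
square-mono {a} {b} 0≤a a≤b = ≤-trans
  (*-monoˡ-≤-nonNeg a {{ℚ.nonNegative 0≤a}} a≤b)
  (*-monoʳ-≤-nonNeg b {{ℚ.nonNegative (≤-trans 0≤a a≤b)}} a≤b)

0≤+ : ∀ {a b} → 0ℚ ≤ a → 0ℚ ≤ b → 0ℚ ≤ a ℚ.+ b
0≤+ {a} {b} 0≤a 0≤b = subst (_≤ a ℚ.+ b) (+-identityʳ 0ℚ) (+-mono-≤ 0≤a 0≤b)

sqrtApprox-upper : ∀ q n →
  q ℚ.⊔ 0ℚ < (sqrtApprox q n ℚ.+ unit n) ℚ.* (sqrtApprox q n ℚ.+ unit n)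
sqrtApprox-upper q n = <-≤-trans
  (<frac² p {{⊔0-nonNeg q}} (suc (isqrt k)) d-1
    (subst (ℕ._< suc (isqrt k) ℕ.* suc (isqrt k) ℕ.* ↧ₙ p)
      (regroup ℤ.∣ ↥ p ∣ (↧ₙ p) (suc n))
      (ℕ.*-monoˡ-< (↧ₙ p) (isqrt-upper k))))
  (square-mono
    (frac-nonNeg (suc (isqrt k)) d-1)
    (subst (_≤ sqrtApprox q n ℚ.+ unit n) (sym (frac-suc (isqrt k) d-1))
      (+-monoʳ-≤ (sqrtApprox q n)
        (unit-antitone (ℕ.m≤m+n n (ℚ.denominator-1 p ℕ.* suc n))))))
  where
  p = q ℚ.⊔ 0ℚ
  k = ℤ.∣ ↥ p ∣ ℕ.* ↧ₙ p ℕ.* (suc n ℕ.* suc n)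
  d-1 = n ℕ.+ ℚ.denominator-1 p ℕ.* suc n

⊔0-step : ∀ {a b h} → 0ℚ ≤ h → a ≤ b ℚ.+ h → a ℚ.⊔ 0ℚ ≤ (b ℚ.⊔ 0ℚ) ℚ.+ h
⊔0-step {a} {b} {h} 0≤h a≤b+h = ⊔-lub
  (≤-trans a≤b+h (+-monoˡ-≤ h (p≤p⊔q b 0ℚ)))
  (0≤+ (p≤q⊔p b 0ℚ) 0≤h)

*-nonNeg : ∀ {a b} → 0ℚ ≤ a → 0ℚ ≤ b → 0ℚ ≤ a ℚ.* b
*-nonNeg {a} {b} 0≤a 0≤b = nonNegative⁻¹ (a ℚ.* b)
  {{nonNeg*nonNeg⇒nonNeg a {{ℚ.nonNegative 0≤a}} b {{ℚ.nonNegative 0≤b}}}}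

root-close : ∀ s t h {p p′} → 0ℚ ≤ t → 0ℚ ≤ h →
  s ℚ.* s ≤ p → p′ < (t ℚ.+ h) ℚ.* (t ℚ.+ h) → p ≤ p′ ℚ.+ h ℚ.* h →
  s < t ℚ.+ (h ℚ.+ h)
root-close s t h {p} {p′} 0≤t 0≤h s²≤p p′<[t+h]² p≤p′+h² = ≰⇒> λ t+2h≤s →
  <-irrefl {c} refl (≤-<-trans (lower t+2h≤s) upper)
  where
  c = (t ℚ.+ h) ℚ.* (t ℚ.+ h) ℚ.+ h ℚ.* h
  0≤[t+h]h : 0ℚ ≤ (t ℚ.+ h) ℚ.* h
  0≤[t+h]h = *-nonNeg (0≤+ 0≤t 0≤h) 0≤h
  lower : t ℚ.+ (h ℚ.+ h) ≤ s → c ≤ p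
  lower t+2h≤s = ≤-trans
    (subst₂ _≤_ (+-identityʳ c) (sym (square-shift t h))
      (+-monoʳ-≤ c (0≤+ 0≤[t+h]h 0≤[t+h]h)))
    (≤-trans (square-mono (0≤+ 0≤t (0≤+ 0≤h 0≤h)) t+2h≤s) s²≤p)
  upper : p < c
  upper = ≤-<-trans p≤p′+h² (+-monoˡ-< (h ℚ.* h) p′<[t+h]²)

sqrtApprox-close : ∀ a b m n h → 0ℚ < h → unit n ≤ h → a ≤ b ℚ.+ h ℚ.* h →
  sqrtApprox a m < sqrtApprox b n ℚ.+ (h ℚ.+ h)
sqrtApprox-close a b m n h h>0 un≤h a≤b+h² =
  root-close (sqrtApprox a m) (sqrtApprox b n) h
    (sqrtApprox-nonNeg b n) (<⇒≤ h>0)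
    (sqrtApprox-lower a m)
    (<-≤-trans (sqrtApprox-upper b n)
      (square-mono (0≤+ (sqrtApprox-nonNeg b n) (unit-nonNeg n))
        (+-monoʳ-≤ (sqrtApprox b n) un≤h)))
    (⊔0-step {a} {b} (*-nonNeg (<⇒≤ h>0) (<⇒≤ h>0)) a≤b+h²)

h²-pos : ∀ {h} → 0ℚ < h → 0ℚ < h ℚ.* h
h²-pos {h} h>0 = positive⁻¹ (h ℚ.* h) {{pos*pos⇒pos h {{ℚ.positive h>0}} h {{ℚ.positive h>0}}}}

-- The square root of max(x, 0); see 0≤sqrt and sqrt-square below.
sqrt : ℝ → ℝ
sqrt x = mkℝ (λ n → sqrtApprox (seq x n) n) isC
  where
  isC : IsCauchy (λ n → sqrtApprox (seq x n) n)
  isC ε ε>0 =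
    let h = ½ ℚ.* ε
        h>0 = half-pos ε>0
        K , small = archimedean h h>0
        N , c = cauchy x (h ℚ.* h) (h²-pos h>0)
        close : ∀ m n → K ℕ.⊔ N ℕ.≤ m → K ℕ.⊔ N ℕ.≤ n →
                sqrtApprox (seq x m) m < sqrtApprox (seq x n) n ℚ.+ ε
        close m n lm ln =
          subst (λ e → sqrtApprox (seq x m) m < sqrtApprox (seq x n) n ℚ.+ e) (half+half ε)
            (sqrtApprox-close (seq x m) (seq x n) m n h h>0
              (≤-trans (unit-antitone (ℕ.m⊔n≤o⇒m≤o K N ln)) small)
              (subst (seq x m ≤_) (+-comm (h ℚ.* h) (seq x n))
                (<⇒≤ (∣∣<⇒< (c m n (ℕ.m⊔n≤o⇒n≤o K N lm) (ℕ.m⊔n≤o⇒n≤o K N ln))))))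
    in K ℕ.⊔ N , λ m n lm ln → ∣∣<-intro (close m n lm ln) (close n m ln lm)

0≤sqrt : ∀ x → 0ℝ ≤ℝ sqrt x
0≤sqrt x ε ε>0 = 0 , λ n _ → 0≤+ (sqrtApprox-nonNeg (seq x n) n) (<⇒≤ ε>0)

sqrt-square : ∀ x → 0ℝ ≤ℝ x → sqrt x * sqrt x ≈ x
sqrt-square x 0≤x ε ε>0 =
  let B , B>0 , L , bound = eventually-bounded (sqrt x)
      C = B ℚ.+ B ℚ.+ 1ℚ
      C>0 = <-≤-trans (positive⁻¹ 1ℚ)
              (subst (_≤ C) (+-identityˡ 1ℚ) (+-monoˡ-≤ 1ℚ (0≤+ (<⇒≤ B>0) (<⇒≤ B>0))))
      δ , δ>0 , Cδ = shrink C ε C>0 ε>0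
      K , small = archimedean δ δ>0
      M , nonneg = 0≤x (½ ℚ.* ε) (half-pos ε>0)
  in (L ℕ.⊔ K) ℕ.⊔ M , λ n le →
    let s = sqrtApprox (seq x n) n
        s≤B : s ≤ B
        s≤B = ≤-trans (p≤∣p∣ s)
          (bound n (ℕ.m⊔n≤o⇒m≤o L K (ℕ.m⊔n≤o⇒m≤o (L ℕ.⊔ K) M le)))
        u≤δ : unit n ≤ δ
        u≤δ = ≤-trans (unit-antitone (ℕ.m⊔n≤o⇒n≤o L K (ℕ.m⊔n≤o⇒m≤o (L ℕ.⊔ K) M le))) small
        0≤x+h : 0ℚ ≤ seq x n ℚ.+ ½ ℚ.* ε
        0≤x+h = nonneg n (ℕ.m⊔n≤o⇒n≤o (L ℕ.⊔ K) M le)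
        h<ε : ½ ℚ.* ε < ε
        h<ε = subst₂ _<_ (+-identityʳ (½ ℚ.* ε)) (half+half ε)
                (+-monoʳ-< (½ ℚ.* ε) (half-pos ε>0))
        x≤x+h : seq x n ≤ seq x n ℚ.+ ½ ℚ.* ε
        x≤x+h = subst (_≤ seq x n ℚ.+ ½ ℚ.* ε) (+-identityʳ (seq x n))
                  (+-monoʳ-≤ (seq x n) (<⇒≤ (half-pos ε>0)))
        error : (s ℚ.+ s ℚ.+ unit n) ℚ.* unit n ≤ ε
        error = ≤-trans
          (*-monoʳ-≤-nonNeg (unit n) {{ℚ.nonNegative (unit-nonNeg n)}}
            (+-mono-≤ (+-mono-≤ s≤B s≤B) (unit-antitone {0} {n} ℕ.z≤n)))
          (subst (C ℚ.* unit n ≤_) Cδ (*-monoˡ-≤-nonNeg C {{ℚ.nonNegative (<⇒≤ C>0)}} u≤δ))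
    in ∣∣<-intro
         (≤-<-trans (≤-trans (sqrtApprox-lower (seq x n) n) (⊔-lub x≤x+h 0≤x+h))
           (+-monoʳ-< (seq x n) h<ε))
         (≤-<-trans (p≤p⊔q (seq x n) 0ℚ)
           (<-≤-trans (sqrtApprox-upper (seq x n) n)
             (subst (_≤ s ℚ.* s ℚ.+ ε) (sym (square-expand s (unit n)))
               (+-monoʳ-≤ (s ℚ.* s) error))))

ℝ²-setoid : Setoid 0ℓ 0ℓ
ℝ²-setoid = ×-setoid ℝ-setoid ℝ-setoid

ℝ² : Set
ℝ² = ℝ × ℝ

dist : ℝ² → ℝ² → ℝ
dist (x₁ , x₂) (y₁ , y₂) = sqrt ((x₁ - y₁) * (x₁ - y₁) + (x₂ - y₂) * (x₂ - y₂))

-- An arbitrary function from the plane to k colours.  The cong field of Func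
-- only says that different Cauchy sequences for the same point get the same
-- colour.
Colouring : ℕ → Set
Colouring k = Func ℝ²-setoid (setoid (Fin k))

open Func public using () renaming (to to colour)

IsProper : ∀ {k} → Colouring k → Set
IsProper c = ∀ x y → dist x y ≈ 1ℝ → colour c x ≢ colour c y

Colourable : ℕ → Set
Colourable k = ∃ λ (c : Colouring k) → IsProper c

IsChromaticNumber : ℕ → Set
IsChromaticNumber χ = Colourable χ × (∀ k → Colourable k → χ ℕ.≤ k)

{-# OPTIONS --safe #-}
-- All lemmas are about arbitrary 4-colourings of the plane, and a colouring
-- composed with a rigid motion is again a colouring, so each lemma holds for
-- every copy of the configuration it mentions.  "Contradiction" always means
-- that two points at distance 1 have the same colour.  Let ω = exp(iπ/3).
--
-- An equilateral triangle of side √3 is never monochromatic (de Grey): this is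
-- a finite case distinction over sums of a few of the unit vectors ωʲ ζᵏ,
-- where |k| ≤ 2 and ζ² has real part 5/6, so that ζ² turns √3 by a chord of
-- length 1.
--
-- Colour the 31 points of the triangular lattice at distance at most √7 from a
-- lattice point O so that no such triangle is monochromatic, and consider the
-- pairs O ± 2ωᵏ.  A finite case distinction shows that both points of some
-- pair have the colour of O, and that, if O + 2 and O - 2 have different
-- colours, every pair has at least one point with the colour of O.  The first
-- fact, applied to the lattice turned about O by the angle that moves points at
-- distance 2 by 1, contradicts the second.  Hence points at distance 4 have the
-- same colour, and an isosceles triangle with sides 4, 4, 1 finishes the proof.
module Submission where

open import Defs
open import Data.Nat.Base using (ℕ; _≤_)
open import Data.Product.Base using (∃₂; _×_)
open import Relation.Binary.PropositionalEquality using (_≡_)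

import Algebra.Properties.Semiring.Mult as Mult
open import Algebra.Bundles using (CommutativeRing)
open import Data.Bool.Base using (Bool; true; false; T; _∧_; if_then_else_)
open import Data.Bool.ListAction using (any; all)
open import Data.Bool.Properties using (T-≡; T-∧)
open import Data.Empty using (⊥)
open import Data.Fin.Base using (Fin; inject≤)
open import Data.Fin.Patterns using (0F; 1F; 2F; 3F; 4F; 5F; 6F; 7F)
open import Data.Fin.Properties using (_≟_; all?; inject≤-injective)
import Data.Integer.Base as ℤ
open import Data.List.Base using (List; []; _∷_; _++_; allFin; concatMap)
import Data.List.Membership.DecPropositional as DecMembership
open import Data.List.Membership.Propositional using (_∈_)
open import Data.List.Membership.Propositional.Properties using (∈-allFin)
open import Data.List.Relation.Unary.All as All using (All; []; _∷_)
open import Data.List.Relation.Unary.All.Properties using (all⁺; concat⁺; map⁺; ++⁺)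
open import Data.List.Relation.Unary.Any as Any using (here; there)
open import Data.List.Relation.Unary.Any.Properties using (any⁻)
import Data.Nat.Base as ℕ
import Data.Nat.Properties as ℕ
open import Data.Product.Base using (∃; _,_; proj₁; proj₂)
open import Data.Product.Properties using (≡-dec)
open import Data.Rational.Base as ℚ using (ℚ; 0ℚ; 1ℚ; ½; ∣_∣; _/_)
import Data.Rational.Properties as ℚ
import Data.Rational.Solver as ℚSolver
open import Data.Sum.Base using (_⊎_; inj₁; inj₂; [_,_]′)
open import Data.Unit.Base using (tt)
open import Data.Vec.Base using (Vec; []; _∷_; lookup; updateAt)
open import Data.Vec.Properties using (lookup∘updateAt; lookup∘updateAt′)
open import Function.Bundles using (Equivalence; Func)
open import Relation.Binary.Definitions using (DecidableEquality)
open import Relation.Binary.PropositionalEquality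
  using (_≢_; refl; sym; trans; cong; cong₂; subst; subst₂)
open import Relation.Nullary using (yes; no; does; contradiction)
open import Relation.Nullary.Decidable using (⌊_⌋; toWitness; _⊎-dec_; _×-dec_; ¬?)

open ℚSolver.+-*-Solver using (solve; _:=_; _:+_; _:*_; _:-_; :-_; con)

-- Real arithmetic

-- Equality of reals, on the underlying sequences only: this keeps the type
-- checker from comparing Cauchy proofs.
infix 4 _∼_ _≋_
record _∼_ (f g : ℕ → ℚ) : Set where
  constructor wrap
  field unwrap : ∀ ε → 0ℚ ℚ.< ε → ∃ λ N → ∀ n → N ℕ.≤ n → ∣ f n ℚ.- g n ∣ ℚ.< ε
open _∼_

_≋_ : ℝ → ℝ → Set
x ≋ y = seq x ∼ seq y

≈⇒≋ : ∀ x y → x ≈ y → x ≋ y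
≈⇒≋ x y = wrap

pointwise : ∀ {f g} → (∀ n → f n ≡ g n) → f ∼ g
pointwise {f} {g} eq = wrap λ ε ε>0 → 0 , λ n _ →
  subst (λ t → ∣ t ∣ ℚ.< ε)
    (sym (trans (cong (ℚ._- g n) (eq n)) (ℚ.+-inverseʳ (g n)))) ε>0

∼-refl : ∀ {f} → f ∼ f
∼-refl = pointwise λ _ → refl

∼-sym : ∀ {f g} → f ∼ g → g ∼ f
∼-sym {f} {g} (wrap e) = wrap λ ε ε>0 →
  let N , c = e ε ε>0
  in N , λ n le → subst (ℚ._< ε) (∣-∣-sym (f n) (g n)) (c n le)

∼-trans : ∀ {f g h} → f ∼ g → g ∼ h → f ∼ h
∼-trans {f} {g} {h} (wrap d) (wrap e) = wrap λ ε ε>0 →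
  let M , c = d (½ ℚ.* ε) (half-pos ε>0)
      N , c′ = e (½ ℚ.* ε) (half-pos ε>0)
  in M ℕ.⊔ N , λ n le → subst (λ t → ∣ t ∣ ℚ.< ε) (sym (telescope (f n) (g n) (h n)))
      (∣a+b∣<ε (f n ℚ.- g n) (g n ℚ.- h n)
        (c n (ℕ.m⊔n≤o⇒m≤o M N le)) (c′ n (ℕ.m⊔n≤o⇒n≤o M N le)))

+-cong : ∀ {f f′ g g′} → f ∼ f′ → g ∼ g′ → (λ n → f n ℚ.+ g n) ∼ (λ n → f′ n ℚ.+ g′ n)
+-cong {f} {f′} {g} {g′} (wrap e) (wrap e′) = wrap λ ε ε>0 →
  let M , c = e (½ ℚ.* ε) (half-pos ε>0)
      N , d = e′ (½ ℚ.* ε) (half-pos ε>0)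
  in M ℕ.⊔ N , λ n le →
    subst (λ t → ∣ t ∣ ℚ.< ε) (sym (+-interchange-neg (f n) (g n) (f′ n) (g′ n)))
      (∣a+b∣<ε (f n ℚ.- f′ n) (g n ℚ.- g′ n)
        (c n (ℕ.m⊔n≤o⇒m≤o M N le)) (d n (ℕ.m⊔n≤o⇒n≤o M N le)))

-‿cong : ∀ {f f′} → f ∼ f′ → (λ n → ℚ.- f n) ∼ (λ n → ℚ.- f′ n)
-‿cong {f} {f′} (wrap e) = wrap λ ε ε>0 →
  let N , c = e ε ε>0
  in N , λ n le → subst (ℚ._< ε)
      (sym (trans (cong ∣_∣ (neg-diff (f n) (f′ n))) (ℚ.∣-p∣≡∣p∣ (f n ℚ.- f′ n))))
      (c n le)

-- The arguments are reals rather than bare sequences, because the bounds on the factors come from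
-- their Cauchy proofs.
*-cong : ∀ x x′ y y′ → x ≋ x′ → y ≋ y′ → x * y ≋ x′ * y′
*-cong x x′ y y′ (wrap e) (wrap f) = wrap λ ε ε>0 →
  let A , A>0 , K , bx = eventually-bounded x
      B , B>0 , L , by = eventually-bounded y′
      α , α>0 , Aα = shrink A (½ ℚ.* ε) A>0 (half-pos ε>0)
      β , β>0 , Bβ = shrink B (½ ℚ.* ε) B>0 (half-pos ε>0)
      M , c = f α α>0
      N , d = e β β>0
  in (K ℕ.⊔ L) ℕ.⊔ (M ℕ.⊔ N) , λ n le →
    let KL≤ = ℕ.m⊔n≤o⇒m≤o (K ℕ.⊔ L) (M ℕ.⊔ N) le
        MN≤ = ℕ.m⊔n≤o⇒n≤o (K ℕ.⊔ L) (M ℕ.⊔ N) le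
    in subst (λ t → ∣ t ∣ ℚ.< ε) (sym (*-diff (seq x n) (seq y n) (seq x′ n) (seq y′ n)))
        (∣ab+cd∣<ε (seq x n) (seq y n ℚ.- seq y′ n) (seq y′ n) (seq x n ℚ.- seq x′ n)
          A>0 B>0 Aα Bβ
          (bx n (ℕ.m⊔n≤o⇒m≤o K L KL≤)) (c n (ℕ.m⊔n≤o⇒m≤o M N MN≤))
          (by n (ℕ.m⊔n≤o⇒n≤o K L KL≤)) (d n (ℕ.m⊔n≤o⇒n≤o M N MN≤)))

-- Ring identities modulo the relations u ≋ 0 and v ≋ 0.
modulo : ∀ u v g h {f k} → u ≋ 0ℝ → v ≋ 0ℝ →
  (∀ n → f n ≡ k n ℚ.+ seq u n ℚ.* seq g n ℚ.+ seq v n ℚ.* seq h n) → f ∼ k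
modulo u v g h {f} {k} u≋0 v≋0 eq =
  ∼-trans (pointwise eq)
  (∼-trans (+-cong (+-cong (∼-refl {k}) (*-cong u 0ℝ g g u≋0 ∼-refl)) (*-cong v 0ℝ h h v≋0 ∼-refl))
    (pointwise λ n → solve 3 (λ y g h → y :+ con 0ℚ :* g :+ con 0ℚ :* h := y) refl
      (k n) (seq g n) (seq h n)))

-- The defining equation of the square root in the form `u ≋ 0ℝ` that `modulo` expects.
root-relation : ∀ q → 0ℚ ℚ.≤ q →
  sqrt (fromℚ q) * sqrt (fromℚ q) - fromℚ q ≋ 0ℝ
root-relation q 0≤q =
  ∼-trans (+-cong (≈⇒≋ (sqrt (fromℚ q) * sqrt (fromℚ q)) (fromℚ q) (sqrt-square (fromℚ q) 0≤fromℚ))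
                  (∼-refl {seq (- fromℚ q)}))
    (pointwise λ _ → ℚ.+-inverseʳ q)
  where
  0≤fromℚ : 0ℝ ≤ℝ fromℚ q
  0≤fromℚ ε ε>0 = 0 , λ _ _ → 0≤+ 0≤q (ℚ.<⇒≤ ε>0)

-- For t ≥ 0 the factor t + 1 is at least 1, so |t - 1| ≤ |t² - 1|: the approximations of `sqrt z`
-- tend to 1 because their squares do.
sqrt-one : ∀ z → z ≋ 1ℝ → sqrt z ≋ 1ℝ
sqrt-one z z≋1 = wrap λ ε ε>0 →
  let N , close = unwrap (∼-trans {h = seq 1ℝ}
        (≈⇒≋ (sqrt z * sqrt z) z (sqrt-square z 0≤z)) z≋1) ε ε>0
  in N , λ n le → ℚ.≤-<-trans (bound (sqrtApprox-nonNeg (seq z n) n)) (close n le)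
  where
  0≤z : 0ℝ ≤ℝ z
  0≤z ε ε>0 =
    -- The tolerance 1 is enough: |1 - z| < 1 already makes `z` positive.
    let N , c = unwrap (∼-sym {seq z} {seq 1ℝ} z≋1) 1ℚ (ℚ.positive⁻¹ 1ℚ)
    in N , λ n le → ℚ.<⇒≤ (ℚ.<-trans
      (subst (0ℚ ℚ.<_) (solve 1 (λ z → :- con 1ℚ :+ (con 1ℚ :+ z) := z) refl (seq z n))
        (ℚ.+-monoʳ-< (ℚ.- 1ℚ) (∣∣<⇒< {1ℚ} {seq z n} (c n le))))
      (subst (ℚ._< seq z n ℚ.+ ε) (ℚ.+-identityʳ (seq z n)) (ℚ.+-monoʳ-< (seq z n) ε>0)))
  bound : ∀ {t} → 0ℚ ℚ.≤ t → ∣ t ℚ.- 1ℚ ∣ ℚ.≤ ∣ t ℚ.* t ℚ.- 1ℚ ∣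
  bound {t} 0≤t = subst₂ ℚ._≤_ (ℚ.*-identityʳ ∣ t ℚ.- 1ℚ ∣)
    (trans (cong (∣ t ℚ.- 1ℚ ∣ ℚ.*_) (sym (ℚ.0≤p⇒∣p∣≡p (0≤+ 0≤t 0≤1))))
      (trans (sym (ℚ.∣p*q∣≡∣p∣*∣q∣ (t ℚ.- 1ℚ) (t ℚ.+ 1ℚ)))
        (cong ∣_∣ (solve 1 (λ t → (t :- con 1ℚ) :* (t :+ con 1ℚ) := t :* t :- con 1ℚ) refl t))))
    (ℚ.*-monoˡ-≤-nonNeg ∣ t ℚ.- 1ℚ ∣ {{ℚ.∣-∣-nonNeg (t ℚ.- 1ℚ)}}
      (subst (ℚ._≤ t ℚ.+ 1ℚ) (ℚ.+-identityˡ 1ℚ) (ℚ.+-monoˡ-≤ 1ℚ 0≤t)))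
    where
    0≤1 = ℚ.<⇒≤ (ℚ.positive⁻¹ 1ℚ)

-- Unit distances and rigid motions

infix 4 _≋²_
_≋²_ : ℝ² → ℝ² → Set
P ≋² Q = proj₁ P ≋ proj₁ Q × proj₂ P ≋ proj₂ Q

dist² : ℝ² → ℝ² → ℝ
dist² (x₁ , x₂) (y₁ , y₂) = (x₁ - y₁) * (x₁ - y₁) + (x₂ - y₂) * (x₂ - y₂)

dist-unit : ∀ P Q → dist² P Q ≋ 1ℝ → dist P Q ≈ 1ℝ
dist-unit P Q e = unwrap (sqrt-one (dist² P Q) e)

-- Squared distances keep the geometry polynomial; the passage to `dist` is left to `dist-unit`. The
-- later lemmas conclude `MonoEdge c` instead of refuting properness, so that the argument exhibits
-- a pair.
MonoEdge : Colouring 4 → Set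
MonoEdge c = ∃₂ λ P Q → dist² P Q ≋ 1ℝ × colour c P ≡ colour c Q

colour-cong : ∀ (c : Colouring 4) P Q → P ≋² Q → colour c P ≡ colour c Q
colour-cong c _ _ (e , f) = Func.cong c (unwrap e , unwrap f)

-- z ↦ (p + q i) z + t on ℝ² = ℂ.
record Motion : Set where
  field
    p q  : ℝ
    t    : ℝ²
    norm : p * p + q * q ≋ 1ℝ

-- These have inferred types, which an opaque block does not allow.
private
  re-difference = solve 7 (λ p q t x y x′ y′ →
    (p :* x :- q :* y :+ t) :- (p :* x′ :- q :* y′ :+ t) := p :* (x :- x′) :- q :* (y :- y′)) refl
  im-difference = solve 7 (λ p q t x y x′ y′ →
    (q :* x :+ p :* y :+ t) :- (q :* x′ :+ p :* y′ :+ t) := q :* (x :- x′) :+ p :* (y :- y′)) refl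
  brahmagupta = solve 4 (λ p q u v →
    (p :* u :- q :* v) :* (p :* u :- q :* v) :+ (q :* u :+ p :* v) :* (q :* u :+ p :* v) :=
    (p :* p :+ q :* q) :* (u :* u :+ v :* v)) refl
  re-displacement = solve 6 (λ p q x y a b →
    x :- (p :* x :- q :* y :+ (a :- (p :* a :- q :* b))) :=
    (con 1ℚ :- p) :* (x :- a) :- (:- q) :* (y :- b)) refl
  im-displacement = solve 6 (λ p q x y a b →
    y :- (q :* x :+ p :* y :+ (b :- (q :* a :+ p :* b))) :=
    (:- q) :* (x :- a) :+ (con 1ℚ :- p) :* (y :- b)) refl
  cancel-shift = solve 2 (λ a x → a :+ (x :- a) := x) refl

-- Opaque (like lattice below), since the type checker would otherwise compare
-- points by unfolding them down to Cauchy proofs.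
opaque
  act : Motion → ℝ² → ℝ²
  act m (x , y) = p * x - q * y + proj₁ t , q * x + p * y + proj₂ t
    where open Motion m

  act-cong : ∀ m P Q → P ≋² Q → act m P ≋² act m Q
  act-cong m (x , y) (x′ , y′) (e , f) =
      +-cong (+-cong (*-cong p p x x′ ∼-refl e) (-‿cong (*-cong q q y y′ ∼-refl f))) ∼-refl
    , +-cong (+-cong (*-cong q q x x′ ∼-refl e) (*-cong p p y y′ ∼-refl f)) ∼-refl
    where open Motion m

  -- The difference of two images is p + q i times the difference of the points, and the squared
  -- modulus is multiplicative.
  act-dist² : ∀ m P Q → dist² (act m P) (act m Q) ≋ dist² P Q
  act-dist² m P@(x , y) Q@(x′ , y′) =
    ∼-trans (pointwise {g = seq ((p * p + q * q) * dist² P Q)} λ n →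
        trans (cong₂ (λ a b → a ℚ.* a ℚ.+ b ℚ.* b)
                (re-difference (seq p n) (seq q n) (seq (proj₁ t) n)
                  (seq x n) (seq y n) (seq x′ n) (seq y′ n))
                (im-difference (seq p n) (seq q n) (seq (proj₂ t) n)
                  (seq x n) (seq y n) (seq x′ n) (seq y′ n)))
          (brahmagupta (seq p n) (seq q n) (seq x n ℚ.- seq x′ n) (seq y n ℚ.- seq y′ n)))
    (∼-trans (*-cong (p * p + q * q) 1ℝ (dist² P Q) (dist² P Q) norm ∼-refl)
      (pointwise λ n → ℚ.*-identityˡ (seq (dist² P Q) n)))
    where open Motion m

move : Motion → Colouring 4 → Colouring 4
move m c = record
  { to   = λ P → colour c (act m P)
  ; cong = λ {P} {Q} (e , f) → colour-cong c (act m P) (act m Q) (act-cong m P Q (wrap e , wrap f))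
  }

MonoEdge-move : ∀ m {c} → MonoEdge (move m c) → MonoEdge c
MonoEdge-move m (P , Q , e , same) = act m P , act m Q , ∼-trans (act-dist² m P Q) e , same

module _ (p q : ℝ) (p²+q²≋1 : p * p + q * q ≋ 1ℝ) (C : ℝ²) where

  rotate : Motion
  rotate = record { p = p ; q = q ; norm = p²+q²≋1
    -- The translation part C - (p + q i) C makes `C` a fixed point.
    ; t = proj₁ C - (p * proj₁ C - q * proj₂ C) , proj₂ C - (q * proj₁ C + p * proj₂ C) }

  opaque
    unfolding act

    rotate-centre : act rotate C ≋² C
    rotate-centre =
        pointwise (λ n → cancel-shift (seq (p * proj₁ C - q * proj₂ C) n) (seq (proj₁ C) n))
      , pointwise (λ n → cancel-shift (seq (q * proj₁ C + p * proj₂ C) n) (seq (proj₂ C) n))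

    -- The displacement of `P` is (1 - p - q i) (P - C), and the squared modulus of this product
    -- factors.
    rotate-dist² : ∀ P → dist² P (act rotate P) ≋ ((1ℝ - p) * (1ℝ - p) + - q * - q) * dist² P C
    rotate-dist² (x , y) = pointwise λ n →
      trans (cong₂ (λ a b → a ℚ.* a ℚ.+ b ℚ.* b)
              (re-displacement (seq p n) (seq q n)
                (seq x n) (seq y n) (seq (proj₁ C) n) (seq (proj₂ C) n))
              (im-displacement (seq p n) (seq q n)
                (seq x n) (seq y n) (seq (proj₁ C) n) (seq (proj₂ C) n)))
        (brahmagupta (1ℚ ℚ.- seq p n) (ℚ.- seq q n)
          (seq x n ℚ.- seq (proj₁ C) n) (seq y n ℚ.- seq (proj₂ C) n))

-- Refutation by exhaustive search

-- split v ts: case distinction on the colour of v, with one subtree for each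
-- colour that is not excluded by the vertices coloured so far.
data Tree : Set where
  split : ℕ → List Tree → Tree

infixr 6 _▸_
_▸_ : ℕ → Tree → Tree
v ▸ t = split v (t ∷ [])

-- A leaf of the search: it passes `check` only if all four colours of `v` are excluded.
stuck : ℕ → Tree
stuck v = split v []

Classes : Set → Set
Classes V = Vec (List V) 4

module _ {V : Set} (decode : ℕ → V) (bad : V → List V → Bool) where

  -- `bad v ws` is meant to say that `v` must not join the colour class `ws`. Trees name vertices by
  -- numbers, which `decode` turns into vertices.
  check : Classes V → Tree → Bool
  checkAll : Classes V → V → List (Fin 4) → List Tree → Bool
  checkBranch : Classes V → V → Fin 4 → List (Fin 4) → List Tree → Bool

  check cs (split v ts) = checkAll cs (decode v) (allFin 4) ts

  checkAll cs v []       ts = true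
  checkAll cs v (x ∷ xs) ts =
    if bad v (lookup cs x) then checkAll cs v xs ts else checkBranch cs v x xs ts

  checkBranch cs v x xs []       = false
  checkBranch cs v x xs (t ∷ ts) = check (updateAt cs x (v ∷_)) t ∧ checkAll cs v xs ts

  module _ {R : Set} (f : V → Fin 4)
    (bad-sound : ∀ v ws → T (bad v ws) → All (λ w → f w ≡ f v) ws → R) where

    Consistent : Classes V → Set
    Consistent cs = ∀ x → All (λ w → f w ≡ x) (lookup cs x)

    extend : ∀ {cs} v → Consistent cs → Consistent (updateAt cs (f v) (v ∷_))
    extend {cs} v ok-cs x with x ≟ f v
    ... | yes refl = subst (All _) (sym (lookup∘updateAt (f v) cs)) (refl ∷ ok-cs x)
    ... | no x≢fv = subst (All _) (sym (lookup∘updateAt′ x (f v) x≢fv cs)) (ok-cs x)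

    -- The search is followed along the true colours: at each vertex the colour `f v` either leads
    -- into a subtree, where the argument continues, or is excluded, and then `bad-sound` yields
    -- `R`. Since `R` is arbitrary, a refutation can return a witness.
    check-sound : ∀ cs t → Consistent cs → T (check cs t) → R
    checkAll-sound : ∀ cs v xs ts → Consistent cs → f v ∈ xs → T (checkAll cs v xs ts) → R
    checkBranch-sound : ∀ cs v x xs ts → Consistent cs → f v ∈ x ∷ xs →
      T (checkBranch cs v x xs ts) → R

    check-sound cs (split v ts) ok-cs ok =
      checkAll-sound cs (decode v) (allFin 4) ts ok-cs (∈-allFin (f (decode v))) ok

    checkAll-sound cs v (x ∷ xs) ts ok-cs fv∈ ok with bad v (lookup cs x) in eq
    ... | false = checkBranch-sound cs v x xs ts ok-cs fv∈ ok
    checkAll-sound cs v (x ∷ xs) ts ok-cs (here refl) ok | true =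
      bad-sound v (lookup cs x) (Equivalence.from T-≡ eq) (ok-cs x)
    checkAll-sound cs v (x ∷ xs) ts ok-cs (there fv∈) ok | true =
      checkAll-sound cs v xs ts ok-cs fv∈ ok

    checkBranch-sound cs v x xs (t ∷ ts) ok-cs fv∈ ok
      with Equivalence.to (T-∧ {check (updateAt cs x (v ∷_)) t}) ok
    checkBranch-sound cs v x xs (t ∷ ts) ok-cs (here refl) ok | ok₁ , _ =
      check-sound (updateAt cs x (v ∷_)) t (extend {cs} v ok-cs) ok₁
    checkBranch-sound cs v x xs (t ∷ ts) ok-cs (there fv∈) ok | _ , ok₂ =
      checkAll-sound cs v xs ts ok-cs fv∈ ok₂

-- For distinct `x`, `y`, `z` this is a permutation; the fourth colour falls through to the default
-- 3.
relabel : Fin 4 → Fin 4 → Fin 4 → Fin 4 → Fin 4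
relabel x y z w =
  if does (w ≟ x) then 0F else if does (w ≟ y) then 1F else if does (w ≟ z) then 2F else 3F

-- Injectivity is stated as a disjunction so that `relabelling` can be decided by running through
-- all colours.
Relabelling : (x y z : Fin 4) → (Fin 4 → Fin 4) → Set
Relabelling x y z π = π x ≡ 0F × π y ≡ 1F × π z ≡ 2F × (∀ v w → π v ≢ π w ⊎ v ≡ w)

relabelling : ∀ x y z → (x ≡ y ⊎ x ≡ z ⊎ y ≡ z) ⊎ Relabelling x y z (relabel x y z)
relabelling = toWitness {a? = all? λ x → all? λ y → all? λ z →
  ((x ≟ y) ⊎-dec ((x ≟ z) ⊎-dec (y ≟ z))) ⊎-dec
  ((_ ≟ _) ×-dec ((_ ≟ _) ×-dec ((_ ≟ _) ×-dec
    (all? λ v → all? λ w → ¬? (_ ≟ _) ⊎-dec (v ≟ w)))))} _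

module _ {V R : Set} (decode : ℕ → V) (bad : V → List V → Bool) (f : V → Fin 4)
  (bad-sound : ∀ v ws → T (bad v ws) → All (λ w → f w ≡ f v) ws → R) where

  -- The search is run on `π` after `f`, whose given classes have the colours 0, 1 and 2.
  -- Injectivity of `π` turns equal new colours back into equal colours under `f`.
  refute-relabelled : ∀ {os as bs} x y z t π → Relabelling x y z π →
    All (λ w → f w ≡ x) os → All (λ w → f w ≡ y) as → All (λ w → f w ≡ z) bs →
    T (check decode bad (os ∷ as ∷ bs ∷ [] ∷ []) t) → R
  refute-relabelled {os} {as} {bs} x y z t π (πx , πy , πz , inj) fo fa fb =
    check-sound decode bad (λ v → π (f v))
      (λ v ws b same → bad-sound v ws b (All.map (injective _ _) same))
      (os ∷ as ∷ bs ∷ [] ∷ []) t consistent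
    where
    injective : ∀ v w → π v ≡ π w → v ≡ w
    injective v w e with inj v w
    ... | inj₁ ne = contradiction e ne
    ... | inj₂ v≡w = v≡w
    consistent : ∀ c → All (λ w → π (f w) ≡ c) (lookup (os ∷ as ∷ bs ∷ [] ∷ []) c)
    consistent 0F = All.map (λ e → trans (cong π e) πx) fo
    consistent 1F = All.map (λ e → trans (cong π e) πy) fa
    consistent 2F = All.map (λ e → trans (cong π e) πz) fb
    consistent 3F = []

  -- By symmetry, the three given colours may be taken to be 0, 1 and 2.
  refute : ∀ {os as bs} x y z t →
    All (λ w → f w ≡ x) os → All (λ w → f w ≡ y) as → All (λ w → f w ≡ z) bs →
    (x ≡ y → R) → (x ≡ z → R) → (y ≡ z → R) →
    T (check decode bad (os ∷ as ∷ bs ∷ [] ∷ []) t) → R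
  refute x y z t fo fa fb x≡y x≡z y≡z ok =
    [ [ x≡y , [ x≡z , y≡z ]′ ]′
    , (λ π → refute-relabelled x y z t (relabel x y z) π fo fa fb ok) ]′
    (relabelling x y z)

-- Coordinates

module ℚMult = Mult (CommutativeRing.semiring ℚ.+-*-commutativeRing)

-- Multiples of 1 are used instead of fractions because the semiring homomorphism lemmas apply to
-- them directly.
ι : ℕ → ℚ
ι n = n ℚMult.× 1ℚ

ι-+ : ∀ m n → ι (m ℕ.+ n) ≡ ι m ℚ.+ ι n
ι-+ = ℚMult.×-homo-+ 1ℚ

ι-* : ∀ m n → ι (m ℕ.* n) ≡ ι m ℚ.* ι n
ι-* = ℚMult.×1-homo-*

-- Semiring expressions, to carry equations from ℕ to ℚ.
infixl 6 _⊕_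
infixl 7 _⊗_
data Expr (n : ℕ) : Set where
  var     : Fin n → Expr n
  num     : ℕ → Expr n
  _⊕_ _⊗_ : Expr n → Expr n → Expr n

⟦_⟧ℕ : ∀ {n} → Expr n → Vec ℕ n → ℕ
⟦ var i ⟧ℕ ρ = lookup ρ i
⟦ num k ⟧ℕ ρ = k
⟦ s ⊕ t ⟧ℕ ρ = ⟦ s ⟧ℕ ρ ℕ.+ ⟦ t ⟧ℕ ρ
⟦ s ⊗ t ⟧ℕ ρ = ⟦ s ⟧ℕ ρ ℕ.* ⟦ t ⟧ℕ ρ

⟦_⟧ℚ : ∀ {n} → Expr n → Vec ℕ n → ℚ
⟦ var i ⟧ℚ ρ = ι (lookup ρ i)
⟦ num k ⟧ℚ ρ = ι k
⟦ s ⊕ t ⟧ℚ ρ = ⟦ s ⟧ℚ ρ ℚ.+ ⟦ t ⟧ℚ ρ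
⟦ s ⊗ t ⟧ℚ ρ = ⟦ s ⟧ℚ ρ ℚ.* ⟦ t ⟧ℚ ρ

ι-⟦⟧ : ∀ {n} (t : Expr n) ρ → ι (⟦ t ⟧ℕ ρ) ≡ ⟦ t ⟧ℚ ρ
ι-⟦⟧ (var i) ρ = refl
ι-⟦⟧ (num k) ρ = refl
ι-⟦⟧ (s ⊕ t) ρ = trans (ι-+ (⟦ s ⟧ℕ ρ) (⟦ t ⟧ℕ ρ)) (cong₂ ℚ._+_ (ι-⟦⟧ s ρ) (ι-⟦⟧ t ρ))
ι-⟦⟧ (s ⊗ t) ρ = trans (ι-* (⟦ s ⟧ℕ ρ) (⟦ t ⟧ℕ ρ)) (cong₂ ℚ._*_ (ι-⟦⟧ s ρ) (ι-⟦⟧ t ρ))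

⟦⟧-cong : ∀ {n} (s t : Expr n) ρ → ⟦ s ⟧ℕ ρ ≡ ⟦ t ⟧ℕ ρ → ⟦ s ⟧ℚ ρ ≡ ⟦ t ⟧ℚ ρ
⟦⟧-cong s t ρ e = trans (sym (ι-⟦⟧ s ρ)) (trans (cong ι e) (ι-⟦⟧ t ρ))

-- These suffice for the search: ζ² = (5 + i√11) / 6 and ζ = (√33 + i√3) / 6, while ω needs only √3.
-- This also accounts for the denominator 6 of the codes.
√3 √11 : ℝ
√3  = sqrt (fromℚ (ι 3))
√11 = sqrt (fromℚ (ι 11))

√3² : √3 * √3 - fromℚ (ι 3) ≋ 0ℝ
√3² = root-relation (ι 3) (ℚ.nonNegative⁻¹ (ι 3))

√11² : √11 * √11 - fromℚ (ι 11) ≋ 0ℝ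
√11² = root-relation (ι 11) (ℚ.nonNegative⁻¹ (ι 11))

-- code a b c d stands for (a + b ω + (c + d ω) i√11) / 6, where ω = (1 + i√3) / 2.
record Code : Set where
  constructor code
  field a b c d : ℕ

⅙ : ℚ
⅙ = ℤ.+ 1 / 6

point : Code → ℝ²
point (code a b c d) =
    fromℚ (⅙ ℚ.* (ι a ℚ.+ ½ ℚ.* ι b)) - fromℚ (⅙ ℚ.* (½ ℚ.* ι d)) * (√3 * √11)
  , fromℚ (⅙ ℚ.* (½ ℚ.* ι b)) * √3 + fromℚ (⅙ ℚ.* (ι c ℚ.+ ½ ℚ.* ι d)) * √11

-- For the difference (a + b ω) + (c + d ω) i√11 of two codes this says
-- b c = a d and a² + a b + b² + 11 (c² + c d + d²) = 36, with the negative
-- terms moved to the other side.  Constants stand on the right because Agda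
-- would unfold k * x and k + x for a literal k.
adjacent : Code → Code → Bool
adjacent (code a b c d) (code a′ b′ c′ d′) =
    (b ℕ.* c ℕ.+ b′ ℕ.* c′ ℕ.+ (a ℕ.* d′ ℕ.+ a′ ℕ.* d)
      ℕ.≡ᵇ b ℕ.* c′ ℕ.+ b′ ℕ.* c ℕ.+ (a ℕ.* d ℕ.+ a′ ℕ.* d′))
  ∧ (a ℕ.* a ℕ.+ a ℕ.* b ℕ.+ b ℕ.* b ℕ.+ (a′ ℕ.* a′ ℕ.+ a′ ℕ.* b′ ℕ.+ b′ ℕ.* b′)
       ℕ.+ (c ℕ.* c ℕ.+ c ℕ.* d ℕ.+ d ℕ.* d ℕ.+ (c′ ℕ.* c′ ℕ.+ c′ ℕ.* d′ ℕ.+ d′ ℕ.* d′)) ℕ.* 11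
     ℕ.≡ᵇ (a ℕ.* a′ ℕ.+ b ℕ.* b′) ℕ.* 2 ℕ.+ (a ℕ.* b′ ℕ.+ a′ ℕ.* b)
       ℕ.+ ((c ℕ.* c′ ℕ.+ d ℕ.* d′) ℕ.* 2 ℕ.+ (c ℕ.* d′ ℕ.+ c′ ℕ.* d)) ℕ.* 11 ℕ.+ 36)

module _ (a b c d a′ b′ c′ d′ : ℕ) where
  private
    ρ : Vec ℕ 8
    ρ = a ∷ b ∷ c ∷ d ∷ a′ ∷ b′ ∷ c′ ∷ d′ ∷ []
    A B C D A′ B′ C′ D′ : Expr 8
    A = var 0F; B = var 1F; C = var 2F; D = var 3F
    A′ = var 4F; B′ = var 5F; C′ = var 6F; D′ = var 7F
    ℓ₁ r₁ ℓ₂ r₂ : Expr 8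
    ℓ₁ = B ⊗ C ⊕ B′ ⊗ C′ ⊕ (A ⊗ D′ ⊕ A′ ⊗ D)
    r₁ = B ⊗ C′ ⊕ B′ ⊗ C ⊕ (A ⊗ D ⊕ A′ ⊗ D′)
    ℓ₂ = A ⊗ A ⊕ A ⊗ B ⊕ B ⊗ B ⊕ (A′ ⊗ A′ ⊕ A′ ⊗ B′ ⊕ B′ ⊗ B′)
      ⊕ (C ⊗ C ⊕ C ⊗ D ⊕ D ⊗ D ⊕ (C′ ⊗ C′ ⊕ C′ ⊗ D′ ⊕ D′ ⊗ D′)) ⊗ num 11
    r₂ = (A ⊗ A′ ⊕ B ⊗ B′) ⊗ num 2 ⊕ (A ⊗ B′ ⊕ A′ ⊗ B)
      ⊕ ((C ⊗ C′ ⊕ D ⊗ D′) ⊗ num 2 ⊕ (C ⊗ D′ ⊕ C′ ⊗ D)) ⊗ num 11 ⊕ num 36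

    Δa = ι a ℚ.- ι a′
    Δb = ι b ℚ.- ι b′
    Δc = ι c ℚ.- ι c′
    Δd = ι d ℚ.- ι d′

    -- If u + v i√11 is the difference of the two codes before division by 6, its squared modulus is
    -- `Form₂` + √33 `Form₁`.
    Form₁ = Δb ℚ.* Δc ℚ.- Δa ℚ.* Δd
    Form₂ = Δa ℚ.* Δa ℚ.+ Δa ℚ.* Δb ℚ.+ Δb ℚ.* Δb
      ℚ.+ ι 11 ℚ.* (Δc ℚ.* Δc ℚ.+ Δc ℚ.* Δd ℚ.+ Δd ℚ.* Δd)

    form₁ : ⟦ ℓ₁ ⟧ℚ ρ ≡ ⟦ r₁ ⟧ℚ ρ → Form₁ ≡ 0ℚ
    form₁ e = trans
      (solve 8 (λ a b c d a′ b′ c′ d′ →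
        (b :- b′) :* (c :- c′) :- (a :- a′) :* (d :- d′) :=
        (b :* c :+ b′ :* c′ :+ (a :* d′ :+ a′ :* d)) :-
        (b :* c′ :+ b′ :* c :+ (a :* d :+ a′ :* d′))) refl
        (ι a) (ι b) (ι c) (ι d) (ι a′) (ι b′) (ι c′) (ι d′))
      (trans (cong (ℚ._- ⟦ r₁ ⟧ℚ ρ) e) (ℚ.+-inverseʳ (⟦ r₁ ⟧ℚ ρ)))

    form₂ : ⟦ ℓ₂ ⟧ℚ ρ ≡ ⟦ r₂ ⟧ℚ ρ → Form₂ ≡ ι 36
    form₂ e = trans
      (solve 8 (λ a b c d a′ b′ c′ d′ →
        (a :- a′) :* (a :- a′) :+ (a :- a′) :* (b :- b′) :+ (b :- b′) :* (b :- b′)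
          :+ con (ι 11) :*
             ((c :- c′) :* (c :- c′) :+ (c :- c′) :* (d :- d′) :+ (d :- d′) :* (d :- d′)) :=
        (a :* a :+ a :* b :+ b :* b :+ (a′ :* a′ :+ a′ :* b′ :+ b′ :* b′)
          :+ (c :* c :+ c :* d :+ d :* d :+ (c′ :* c′ :+ c′ :* d′ :+ d′ :* d′)) :* con (ι 11))
        :- ((a :* a′ :+ b :* b′) :* con (ι 2) :+ (a :* b′ :+ a′ :* b)
          :+ ((c :* c′ :+ d :* d′) :* con (ι 2) :+ (c :* d′ :+ c′ :* d)) :* con (ι 11)
          :+ con (ι 36))
        :+ con (ι 36)) refl
        (ι a) (ι b) (ι c) (ι d) (ι a′) (ι b′) (ι c′) (ι d′))
      (trans (cong (λ t → t ℚ.- ⟦ r₂ ⟧ℚ ρ ℚ.+ ι 36) e)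
        (trans (cong (ℚ._+ ι 36) (ℚ.+-inverseʳ (⟦ r₂ ⟧ℚ ρ))) (ℚ.+-identityˡ (ι 36))))

    ¼ = ½ ℚ.* ½
    1/36 = ⅙ ℚ.* ⅙

    real : ∀ m → (⅙ ℚ.* (ι a ℚ.+ ½ ℚ.* ι b) ℚ.- ⅙ ℚ.* (½ ℚ.* ι d) ℚ.* m)
               ℚ.- (⅙ ℚ.* (ι a′ ℚ.+ ½ ℚ.* ι b′) ℚ.- ⅙ ℚ.* (½ ℚ.* ι d′) ℚ.* m)
      ≡ ⅙ ℚ.* (Δa ℚ.+ ½ ℚ.* Δb ℚ.- ½ ℚ.* Δd ℚ.* m)
    real m = solve 7 (λ a b d a′ b′ d′ m →
        (con ⅙ :* (a :+ con ½ :* b) :- con ⅙ :* (con ½ :* d) :* m)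
        :- (con ⅙ :* (a′ :+ con ½ :* b′) :- con ⅙ :* (con ½ :* d′) :* m) :=
        con ⅙ :* ((a :- a′) :+ con ½ :* (b :- b′) :- con ½ :* (d :- d′) :* m)) refl
      (ι a) (ι b) (ι d) (ι a′) (ι b′) (ι d′) m

    imag : ∀ s r → (⅙ ℚ.* (½ ℚ.* ι b) ℚ.* s ℚ.+ ⅙ ℚ.* (ι c ℚ.+ ½ ℚ.* ι d) ℚ.* r)
                 ℚ.- (⅙ ℚ.* (½ ℚ.* ι b′) ℚ.* s ℚ.+ ⅙ ℚ.* (ι c′ ℚ.+ ½ ℚ.* ι d′) ℚ.* r)
      ≡ ⅙ ℚ.* (½ ℚ.* Δb ℚ.* s ℚ.+ (Δc ℚ.+ ½ ℚ.* Δd) ℚ.* r)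
    imag s r = solve 8 (λ b c d b′ c′ d′ s r →
        (con ⅙ :* (con ½ :* b) :* s :+ con ⅙ :* (c :+ con ½ :* d) :* r)
        :- (con ⅙ :* (con ½ :* b′) :* s :+ con ⅙ :* (c′ :+ con ½ :* d′) :* r) :=
        con ⅙ :* (con ½ :* (b :- b′) :* s :+ ((c :- c′) :+ con ½ :* (d :- d′)) :* r)) refl
      (ι b) (ι c) (ι d) (ι b′) (ι c′) (ι d′) s r

    -- `G` and `H` are the cofactors of s² - 3 and r² - 11 when the squared distance, with s for √3
    -- and r for √11, is reduced by these relations; the argument of `G` is r².
    G : ℚ → ℚ
    G R = 1/36 ℚ.* (¼ ℚ.* (Δd ℚ.* Δd) ℚ.* R ℚ.+ ¼ ℚ.* (Δb ℚ.* Δb))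

    H : ℚ
    H = 1/36 ℚ.* (¼ ℚ.* ι 3 ℚ.* (Δd ℚ.* Δd) ℚ.+ (Δc ℚ.+ ½ ℚ.* Δd) ℚ.* (Δc ℚ.+ ½ ℚ.* Δd))

    expand = solve 6 (λ a b c d s r →
      let x = con ⅙ :* (a :+ con ½ :* b :- con ½ :* d :* (s :* r))
          y = con ⅙ :* (con ½ :* b :* s :+ (c :+ con ½ :* d) :* r)
          e = c :+ con ½ :* d
      in x :* x :+ y :* y :=
        con 1/36 :* (a :* a :+ a :* b :+ b :* b :+ con (ι 11) :* (c :* c :+ c :* d :+ d :* d))
        :+ con 1/36 :* (b :* c :- a :* d) :* (s :* r)
        :+ (s :* s :- con (ι 3)) :*
           (con 1/36 :* (con ¼ :* (d :* d) :* (r :* r) :+ con ¼ :* (b :* b)))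
        :+ (r :* r :- con (ι 11)) :* (con 1/36 :* (con ¼ :* con (ι 3) :* (d :* d) :+ e :* e)))
      refl

    vanish : ∀ m → 1/36 ℚ.* ι 36 ℚ.+ 1/36 ℚ.* 0ℚ ℚ.* m ≡ 1ℚ
    vanish = solve 1 (λ m → con 1/36 :* con (ι 36) :+ con 1/36 :* con 0ℚ :* m := con 1ℚ) refl

    form-dist² : Form₁ ≡ 0ℚ → Form₂ ≡ ι 36 →
      dist² (point (code a b c d)) (point (code a′ b′ c′ d′)) ≋ 1ℝ
    form-dist² e₁ e₂ = modulo (√3 * √3 - fromℚ (ι 3)) (√11 * √11 - fromℚ (ι 11))
      (fromℚ 1/36 * (fromℚ (¼ ℚ.* (Δd ℚ.* Δd)) * (√11 * √11) + fromℚ (¼ ℚ.* (Δb ℚ.* Δb))))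
      (fromℚ H) √3² √11² λ n → identity (seq √3 n) (seq √11 n)
      where
      identity : ∀ s r → _ ≡ 1ℚ ℚ.+ (s ℚ.* s ℚ.- ι 3) ℚ.* G (r ℚ.* r) ℚ.+ (r ℚ.* r ℚ.- ι 11) ℚ.* H
      identity s r = trans (cong₂ (λ x y → x ℚ.* x ℚ.+ y ℚ.* y) (real (s ℚ.* r)) (imag s r))
        (trans (expand Δa Δb Δc Δd s r)
          (cong (λ t → t ℚ.+ (s ℚ.* s ℚ.- ι 3) ℚ.* G (r ℚ.* r) ℚ.+ (r ℚ.* r ℚ.- ι 11) ℚ.* H)
            (trans (cong₂ (λ x y → 1/36 ℚ.* x ℚ.+ 1/36 ℚ.* y ℚ.* (s ℚ.* r)) e₂ e₁)
                   (vanish (s ℚ.* r)))))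

  -- The Boolean test gives equations in ℕ; `⟦⟧-cong` carries them to ℚ, where `form₁` and `form₂`
  -- restore the differences.
  adjacent-code-sound : T (adjacent (code a b c d) (code a′ b′ c′ d′)) →
    dist² (point (code a b c d)) (point (code a′ b′ c′ d′)) ≋ 1ℝ
  adjacent-code-sound adj =
    let t₁ , t₂ = Equivalence.to (T-∧ {⟦ ℓ₁ ⟧ℕ ρ ℕ.≡ᵇ ⟦ r₁ ⟧ℕ ρ}) adj in
    form-dist² (form₁ (⟦⟧-cong ℓ₁ r₁ ρ (ℕ.≡ᵇ⇒≡ (⟦ ℓ₁ ⟧ℕ ρ) (⟦ r₁ ⟧ℕ ρ) t₁)))
               (form₂ (⟦⟧-cong ℓ₂ r₂ ρ (ℕ.≡ᵇ⇒≡ (⟦ ℓ₂ ⟧ℕ ρ) (⟦ r₂ ⟧ℕ ρ) t₂)))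

adjacent-sound : ∀ v w → T (adjacent v w) → dist² (point v) (point w) ≋ 1ℝ
adjacent-sound (code a b c d) (code a′ b′ c′ d′) = adjacent-code-sound a b c d a′ b′ c′ d′

monoEdge : ∀ c P Q → dist² P Q ≋ 1ℝ → colour c P ≡ colour c Q → MonoEdge c
monoEdge c P Q e same = P , Q , e , same

-- Rotations with rational cosine

module _ (p : ℚ) (0≤1-p² : 0ℚ ℚ.≤ 1ℚ ℚ.- p ℚ.* p) (C : ℝ²) where
  private
    q : ℝ
    q = sqrt (fromℚ (1ℚ ℚ.- p ℚ.* p))

    q² : q * q - fromℚ (1ℚ ℚ.- p ℚ.* p) ≋ 0ℝ
    q² = root-relation (1ℚ ℚ.- p ℚ.* p) 0≤1-p²

    p²+q²≋1 : fromℚ p * fromℚ p + q * q ≋ 1ℝ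
    p²+q²≋1 = modulo (q * q - fromℚ (1ℚ ℚ.- p ℚ.* p)) 0ℝ 1ℝ 0ℝ q² ∼-refl λ n →
      solve 2 (λ p q → p :* p :+ q :* q :=
        con 1ℚ :+ (q :* q :- (con 1ℚ :- p :* p)) :* con 1ℚ :+ con 0ℚ :* con 0ℚ) refl p (seq q n)

  turn : Motion
  turn = rotate (fromℚ p) q p²+q²≋1 C

  turn-centre : act turn C ≋² C
  turn-centre = rotate-centre (fromℚ p) q p²+q²≋1 C

  -- The squared chord is (1 - p)² + q² = 2 (1 - p) times the squared radius `d`.
  turn-dist² : ∀ P d → dist² P C ≋ fromℚ d → (1ℚ ℚ.- p ℚ.+ (1ℚ ℚ.- p)) ℚ.* d ≡ 1ℚ →
    dist² P (act turn P) ≋ 1ℝ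
  turn-dist² P d dist²≋d e =
    ∼-trans (rotate-dist² (fromℚ p) q p²+q²≋1 C P)
    (∼-trans (*-cong chord² (fromℚ (1ℚ ℚ.- p ℚ.+ (1ℚ ℚ.- p))) (dist² P C) (fromℚ d)
        (modulo (q * q - fromℚ (1ℚ ℚ.- p ℚ.* p)) 0ℝ 1ℝ 0ℝ q² ∼-refl λ n →
          solve 2 (λ p q → (con 1ℚ :- p) :* (con 1ℚ :- p) :+ :- q :* :- q :=
            con 1ℚ :- p :+ (con 1ℚ :- p)
            :+ (q :* q :- (con 1ℚ :- p :* p)) :* con 1ℚ :+ con 0ℚ :* con 0ℚ) refl p (seq q n))
        dist²≋d)
      (pointwise λ _ → e))
    where chord² = (1ℝ - fromℚ p) * (1ℝ - fromℚ p) + - q * - q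

-- Lattice points and symmetries of the lattice

≋²-trans : ∀ P Q S → P ≋² Q → Q ≋² S → P ≋² S
≋²-trans _ _ _ (e , f) (e′ , f′) = ∼-trans e e′ , ∼-trans f f′

-- x + y ω
latticeℚ : ℚ → ℚ → ℝ²
latticeℚ x y = fromℚ (x ℚ.+ ½ ℚ.* y) , fromℚ (½ ℚ.* y) * √3

latticeℚ-cong : ∀ {x y x′ y′} → x ≡ x′ → y ≡ y′ → latticeℚ x y ≋² latticeℚ x′ y′
latticeℚ-cong refl refl = ∼-refl , ∼-refl

-- The norm form |u + v ω|² of the Eisenstein integers.
norm² : ℚ → ℚ → ℚ
norm² u v = u ℚ.* u ℚ.+ u ℚ.* v ℚ.+ v ℚ.* v

latticeℚ-dist² : ∀ x y x′ y′ →
  dist² (latticeℚ x y) (latticeℚ x′ y′) ≋ fromℚ (norm² (x ℚ.- x′) (y ℚ.- y′))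
latticeℚ-dist² x y x′ y′ =
  modulo (√3 * √3 - fromℚ (ι 3)) 0ℝ (fromℚ (½ ℚ.* ½ ℚ.* ((y ℚ.- y′) ℚ.* (y ℚ.- y′)))) 0ℝ √3² ∼-refl
    λ k → solve 5 (λ x y x′ y′ s →
      (x :+ con ½ :* y :- (x′ :+ con ½ :* y′)) :* (x :+ con ½ :* y :- (x′ :+ con ½ :* y′))
      :+ (con ½ :* y :* s :- con ½ :* y′ :* s) :* (con ½ :* y :* s :- con ½ :* y′ :* s) :=
      (x :- x′) :* (x :- x′) :+ (x :- x′) :* (y :- y′) :+ (y :- y′) :* (y :- y′)
      :+ (s :* s :- con (ι 3)) :* (con ½ :* con ½ :* ((y :- y′) :* (y :- y′))) :+ con 0ℚ :* con 0ℚ)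
      refl x y x′ y′ (seq √3 k)

opaque
  lattice : ℕ → ℕ → ℝ²
  lattice i j = latticeℚ (ι i) (ι j)

  lattice-dist² : ∀ i j k l →
    dist² (lattice i j) (lattice k l) ≋ fromℚ (norm² (ι i ℚ.- ι k) (ι j ℚ.- ι l))
  lattice-dist² i j k l = latticeℚ-dist² (ι i) (ι j) (ι k) (ι l)

ι-+-cancel : ∀ m m′ i → ι (m ℕ.+ i) ℚ.- ι (m′ ℕ.+ i) ≡ ι m ℚ.- ι m′
ι-+-cancel m m′ i = trans (cong₂ ℚ._-_ (ι-+ m i) (ι-+ m′ i))
  (solve 3 (λ m m′ i → m :+ i :- (m′ :+ i) := m :- m′) refl (ι m) (ι m′) (ι i))

translation halfTurn : ℝ² → Motion
translation v = record { p = 1ℝ ; q = 0ℝ ; t = v ; norm = ∼-refl }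
halfTurn v = record { p = fromℚ (ℚ.- 1ℚ) ; q = 0ℝ ; t = v ; norm = ∼-refl }

opaque
  unfolding act lattice

  translate-lattice : ∀ m n i j →
    act (translation (lattice i j)) (lattice m n) ≋² lattice (m ℕ.+ i) (n ℕ.+ j)
  translate-lattice m n i j = ≋²-trans
    (act (translation (lattice i j)) (lattice m n)) (latticeℚ (ι m ℚ.+ ι i) (ι n ℚ.+ ι j))
    (lattice (m ℕ.+ i) (n ℕ.+ j))
    ( pointwise (λ k → solve 5 (λ m n i j s →
        con 1ℚ :* (m :+ con ½ :* n) :- con 0ℚ :* (con ½ :* n :* s) :+ (i :+ con ½ :* j) :=
        m :+ i :+ con ½ :* (n :+ j)) refl (ι m) (ι n) (ι i) (ι j) (seq √3 k))
    , pointwise (λ k → solve 4 (λ m n j s →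
        con 0ℚ :* (m :+ con ½ :* n) :+ con 1ℚ :* (con ½ :* n :* s) :+ con ½ :* j :* s :=
        con ½ :* (n :+ j) :* s) refl (ι m) (ι n) (ι j) (seq √3 k)))
    (latticeℚ-cong (sym (ι-+ m i)) (sym (ι-+ n j)))

  -- The motion is z ↦ v - z; the coordinates of v are written as sums so that the subtraction never
  -- leaves ℕ.
  halfTurn-lattice : ∀ m n m′ n′ i j →
    act (halfTurn (lattice (m ℕ.+ m′ ℕ.+ i) (n ℕ.+ n′ ℕ.+ j))) (lattice m n) ≋²
    lattice (m′ ℕ.+ i) (n′ ℕ.+ j)
  halfTurn-lattice m n m′ n′ i j = ≋²-trans
    (act (halfTurn (latticeℚ x y)) (lattice m n)) (latticeℚ (x ℚ.- ι m) (y ℚ.- ι n))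
    (lattice (m′ ℕ.+ i) (n′ ℕ.+ j))
    ( pointwise (λ k → solve 5 (λ m n x y s →
        con (ℚ.- 1ℚ) :* (m :+ con ½ :* n) :- con 0ℚ :* (con ½ :* n :* s) :+ (x :+ con ½ :* y) :=
        x :- m :+ con ½ :* (y :- n)) refl (ι m) (ι n) x y (seq √3 k))
    , pointwise (λ k → solve 4 (λ m n y s →
        con 0ℚ :* (m :+ con ½ :* n) :+ con (ℚ.- 1ℚ) :* (con ½ :* n :* s) :+ con ½ :* y :* s :=
        con ½ :* (y :- n) :* s) refl (ι m) (ι n) y (seq √3 k)))
    (latticeℚ-cong (difference m m′ i) (difference n n′ j))
    where
    x y : ℚ
    x = ι (m ℕ.+ m′ ℕ.+ i)
    y = ι (n ℕ.+ n′ ℕ.+ j)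
    difference : ∀ m m′ i → ι (m ℕ.+ m′ ℕ.+ i) ℚ.- ι m ≡ ι (m′ ℕ.+ i)
    difference m m′ i =
      trans (cong (λ t → ι t ℚ.- ι m) (ℕ.+-assoc m m′ i))
      (trans (cong (ℚ._- ι m) (ι-+ m (m′ ℕ.+ i))) (+-swap-diff (ι m) (ι (m′ ℕ.+ i))))

thirdTurn : Motion
thirdTurn = rotate (fromℚ (ℚ.- ½)) (fromℚ ½ * √3)
  (modulo (√3 * √3 - fromℚ (ι 3)) 0ℝ (fromℚ (½ ℚ.* ½)) 0ℝ √3² ∼-refl λ n →
    solve 1 (λ s → con (ℚ.- ½) :* con (ℚ.- ½) :+ con ½ :* s :* (con ½ :* s) :=
      con 1ℚ :+ (s :* s :- con (ι 3)) :* con (½ ℚ.* ½) :+ con 0ℚ :* con 0ℚ) refl (seq √3 n))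
  (lattice 1 1)

opaque
  unfolding act lattice

  -- With the third coordinate m′ = 3 - m - n, the rotation by 2π/3 about (1, 1, 1) permutes the
  -- three coordinates cyclically. All vertices of the hexagon about `lattice 1 1` have m′ in ℕ.
  thirdTurn-lattice : ∀ m n m′ → m′ ℕ.+ m ℕ.+ n ≡ 3 → act thirdTurn (lattice m n) ≋² lattice m′ m
  thirdTurn-lattice m n m′ m′+m+n≡3 = ≋²-trans
    (act thirdTurn (lattice m n)) (latticeℚ (ι 3 ℚ.- (ι m ℚ.+ ι n)) (ι m)) (lattice m′ m)
    ( modulo (√3 * √3 - fromℚ (ι 3)) 0ℝ (fromℚ (½ ℚ.* ½ ℚ.* (1ℚ ℚ.- ι n))) 0ℝ √3² ∼-refl
        (λ k → solve 3 (λ m n s →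
          con (ℚ.- ½) :* (m :+ con ½ :* n) :- con ½ :* s :* (con ½ :* n :* s)
          :+ (con (ι 1 ℚ.+ ½ ℚ.* ι 1) :- (con (ℚ.- ½) :* con (ι 1 ℚ.+ ½ ℚ.* ι 1)
              :- con ½ :* s :* (con (½ ℚ.* ι 1) :* s))) :=
          con (ι 3) :- (m :+ n) :+ con ½ :* m
          :+ (s :* s :- con (ι 3)) :* (con ½ :* con ½ :* (con 1ℚ :- n)) :+ con 0ℚ :* con 0ℚ)
          refl (ι m) (ι n) (seq √3 k))
    , pointwise (λ k → solve 3 (λ m n s →
        con ½ :* s :* (m :+ con ½ :* n) :+ con (ℚ.- ½) :* (con ½ :* n :* s)
        :+ (con (½ ℚ.* ι 1) :* s :- (con ½ :* s :* con (ι 1 ℚ.+ ½ ℚ.* ι 1)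
            :+ con (ℚ.- ½) :* (con (½ ℚ.* ι 1) :* s))) := con ½ :* m :* s)
        refl (ι m) (ι n) (seq √3 k)))
    (latticeℚ-cong {y = ι m} m′≡ refl)
    where
    m′≡ : ι 3 ℚ.- (ι m ℚ.+ ι n) ≡ ι m′
    m′≡ = trans (cong (λ t → ι t ℚ.- (ι m ℚ.+ ι n)) (sym m′+m+n≡3))
      (trans (cong (ℚ._- (ι m ℚ.+ ι n)) (trans (ι-+ (m′ ℕ.+ m) n) (cong (ℚ._+ ι n) (ι-+ m′ m))))
        (solve 3 (λ m n m′ → m′ :+ m :+ n :- (m :+ n) := m′) refl (ι m) (ι n) (ι m′)))

-- The codes carry offsets that make all coordinates natural numbers: the point
-- lattice m n has the code (6 m + 14) (6 n + 14) 5 5.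
toLattice : Motion
toLattice = translation (- proj₁ origin , - proj₂ origin)
  where origin = point (code 14 14 5 5)

opaque
  unfolding act lattice

  toLattice-point : ∀ m n →
    act toLattice (point (code (m ℕ.* 6 ℕ.+ 14) (n ℕ.* 6 ℕ.+ 14) 5 5)) ≋² lattice m n
  toLattice-point m n = ≋²-trans
    (act toLattice (point (code (m ℕ.* 6 ℕ.+ 14) (n ℕ.* 6 ℕ.+ 14) 5 5)))
    (latticeℚ (⅙ ℚ.* (x ℚ.- ι 14)) (⅙ ℚ.* (y ℚ.- ι 14))) (lattice m n)
    ( pointwise (λ k → solve 4 (λ x y s r →
        con 1ℚ :* (con ⅙ :* (x :+ con ½ :* y) :- con (⅙ ℚ.* (½ ℚ.* ι 5)) :* (s :* r))
        :- con 0ℚ :* (con ⅙ :* (con ½ :* y) :* s :+ con (⅙ ℚ.* (ι 5 ℚ.+ ½ ℚ.* ι 5)) :* r)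
        :+ :- (con (⅙ ℚ.* (ι 14 ℚ.+ ½ ℚ.* ι 14)) :- con (⅙ ℚ.* (½ ℚ.* ι 5)) :* (s :* r)) :=
        con ⅙ :* (x :- con (ι 14)) :+ con ½ :* (con ⅙ :* (y :- con (ι 14))))
        refl x y (seq √3 k) (seq √11 k))
    , pointwise (λ k → solve 4 (λ x y s r →
        con 0ℚ :* (con ⅙ :* (x :+ con ½ :* y) :- con (⅙ ℚ.* (½ ℚ.* ι 5)) :* (s :* r))
        :+ con 1ℚ :* (con ⅙ :* (con ½ :* y) :* s :+ con (⅙ ℚ.* (ι 5 ℚ.+ ½ ℚ.* ι 5)) :* r)
        :+ :- (con (⅙ ℚ.* (½ ℚ.* ι 14)) :* s :+ con (⅙ ℚ.* (ι 5 ℚ.+ ½ ℚ.* ι 5)) :* r) :=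
        con ½ :* (con ⅙ :* (y :- con (ι 14))) :* s)
        refl x y (seq √3 k) (seq √11 k)))
    (latticeℚ-cong (rescale m) (rescale n))
    where
    x y : ℚ
    x = ι (m ℕ.* 6 ℕ.+ 14)
    y = ι (n ℕ.* 6 ℕ.+ 14)
    rescale : ∀ m → ⅙ ℚ.* (ι (m ℕ.* 6 ℕ.+ 14) ℚ.- ι 14) ≡ ι m
    rescale m = trans (cong (λ t → ⅙ ℚ.* (t ℚ.- ι 14))
        (trans (ι-+ (m ℕ.* 6) 14) (cong (ℚ._+ ι 14) (ι-* m 6))))
      (solve 1 (λ m → con ⅙ :* (m :* con (ι 6) :+ con (ι 14) :- con (ι 14)) := m) refl (ι m))

-- Triangles of side √3

-- The decimal digits a a b b c d of one number, so that a vertex of the search tree is a single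
-- literal.
decode : ℕ → Code
decode n = code (n ℕ./ 10000) (n ℕ./ 100 ℕ.% 100) (n ℕ./ 10 ℕ.% 10) (n ℕ.% 10)

adjacentToAny : Code → List Code → Bool
adjacentToAny v ws = any (adjacent v) ws

adjacentToAny-sound : ∀ c v ws → T (adjacentToAny v ws) →
  All (λ w → colour c (point w) ≡ colour c (point v)) ws → MonoEdge c
adjacentToAny-sound c v ws adj same =
  let i = any⁻ (adjacent v) ws adj
      fw≡fv , vw = All.lookupAny same i
  in monoEdge c (point v) (point (Any.lookup i)) (adjacent-sound v (Any.lookup i) vw) (sym fw≡fv)

lattice-edge : ∀ c m n m′ n′ → norm² (ι m ℚ.- ι m′) (ι n ℚ.- ι n′) ≡ 1ℚ →
  colour c (lattice m n) ≡ colour c (lattice m′ n′) → MonoEdge c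
lattice-edge c m n m′ n′ e = monoEdge c (lattice m n) (lattice m′ n′)
  (∼-trans (lattice-dist² m n m′ n′) (pointwise λ _ → e))

move-colour : ∀ m c P Q → act m P ≋² Q → colour (move m c) P ≡ colour c Q
move-colour m c P Q = colour-cong c (act m P) Q

-- The classes of the centre lattice 1 1, of the triangle, and of the pair.
triangleClasses : Classes Code
triangleClasses =
  (code 20 20 5 5 ∷ []) ∷ (code 26 20 5 5 ∷ code 14 26 5 5 ∷ code 20 14 5 5 ∷ []) ∷
  (code 20 26 5 5 ∷ code 14 20 5 5 ∷ []) ∷ [] ∷ []

-- The triangle of side √3 formed by every second vertex of the unit hexagon about `lattice 1 1`.
Triangle : Colouring 4 → Set
Triangle c = colour c (lattice 2 1) ≡ colour c (lattice 0 2)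
           × colour c (lattice 0 2) ≡ colour c (lattice 1 0)

-- The tree is a variable here so that the search is evaluated only once.
refute-triangle-with-pair : ∀ t → T (check decode adjacentToAny triangleClasses t) → ∀ c →
  Triangle c → colour c (lattice 1 2) ≡ colour c (lattice 0 1) → MonoEdge c
refute-triangle-with-pair t ok c (t₁ , t₂) e =
  refute decode adjacentToAny f
    (λ v ws adj same →
      MonoEdge-move toLattice {c} (adjacentToAny-sound (move toLattice c) v ws adj same))
    {code 20 20 5 5 ∷ []} {code 26 20 5 5 ∷ code 14 26 5 5 ∷ code 20 14 5 5 ∷ []}
    {code 20 26 5 5 ∷ code 14 20 5 5 ∷ []}
    (colour c (lattice 1 1)) (colour c (lattice 2 1)) (colour c (lattice 1 2)) t
    (at 1 1 20 20 refl refl ∷ [])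
    (at 2 1 26 20 refl refl ∷ trans (at 0 2 14 26 refl refl) (sym t₁)
      ∷ trans (at 1 0 20 14 refl refl) (sym (trans t₁ t₂)) ∷ [])
    (at 1 2 20 26 refl refl ∷ trans (at 0 1 14 20 refl refl) (sym e) ∷ [])
    -- If two of the three given colours agree, a radius or a side of the hexagon is the edge
    -- sought.
    (lattice-edge c 1 1 2 1 refl) (lattice-edge c 1 1 1 2 refl)
    (lattice-edge c 2 1 1 2 refl)
    ok
  where
  f : Code → Fin 4
  f v = colour (move toLattice c) (point v)
  at : ∀ m n a b → a ≡ m ℕ.* 6 ℕ.+ 14 → b ≡ n ℕ.* 6 ℕ.+ 14 →
    f (code a b 5 5) ≡ colour c (lattice m n)
  at m n _ _ refl refl =
    move-colour toLattice c (point (code (m ℕ.* 6 ℕ.+ 14) (n ℕ.* 6 ℕ.+ 14) 5 5)) (lattice m n)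
      (toLattice-point m n)

-- Found by computer search.
triangleTree : Tree
triangleTree =
  split 192164 (split 201956 (212045 ▸ split 202154 (152645 ▸ 261554 ▸ 152144 ▸ 152045 ▸
  211544 ▸ 151544 ▸ 201554 ▸ 142154 ▸ 92144 ▸ 162035 ▸ 191663 ▸ 141653 ▸ 201653 ▸ 202253 ▸
  201053 ▸ 251663 ▸ 192263 ▸ 252164 ▸ 251063 ▸ 212144 ▸ 192764 ▸ 251564 ▸ 262154 ▸ 142754 ▸
  202556 ▸ 191564 ▸ 202754 ▸ 261653 ▸ 262655 ▸ 152546 ▸ 142556 ▸ 192065 ▸ 132164 ▸ 192665 ▸
  212546 ▸ 271445 ▸ 212645 ▸ 192566 ▸ 141956 ▸ 162536 ▸ 202457 ▸ 221936 ▸ 221435 ▸ 162635 ▸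
  251966 ▸ 143057 ▸ 172427 ▸ 251465 ▸ 241855 ▸ 142457 ▸ 232047 ▸ 162338 ▸ 231546 ▸ 172647 ▸
  stuck 172146 ∷ 152645 ▸ 252164 ▸ 152144 ▸ split 192263 (132263 ▸ 212144 ▸ 192764 ▸ 152744 ▸
  212645 ▸ 211544 ▸ 162536 ▸ 202556 ▸ 261554 ▸ 212546 ▸ 162035 ▸ 142556 ▸ 201554 ▸ 311564 ▸
  132764 ▸ 142154 ▸ 182273 ▸ 191663 ▸ 152243 ▸ 241673 ▸ 181673 ▸ 191762 ▸ split 211946 (
  162437 ▸ 152546 ▸ 261455 ▸ 162354 ▸ 152045 ▸ 153146 ▸ 271544 ▸ 142435 ▸ 172465 ▸ 221754 ▸
  132164 ▸ 151544 ▸ 231865 ▸ 191564 ▸ 131663 ▸ 92144 ▸ 192065 ▸ 181772 ▸ 241073 ▸ 141653 ▸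
  181954 ▸ 251465 ▸ 192566 ▸ 171964 ▸ 241574 ▸ 191162 ▸ 172146 ▸ 182455 ▸ 251966 ▸ 242075 ▸
  241172 ▸ 221655 ▸ 182235 ▸ 182257 ▸ 172647 ▸ 202374 ▸ 251366 ▸ 231964 ▸ 301475 ▸ 250964 ▸
  181756 ▸ 182736 ▸ 222156 ▸ 191966 ▸ 231364 ▸ 232465 ▸ 231766 ▸ 182356 ▸ 271665 ▸ 201774 ▸
  181855 ▸ 211847 ▸ 241475 ▸ 241156 ▸ 222354 ▸ 222657 ▸ 192445 ▸ 172245 ▸ 202237 ▸ 251746 ▸
  211566 ▸ 201736 ▸ 122455 ▸ 271847 ▸ 300875 ▸ 202435 ▸ 222057 ▸ 272166 ▸ 232245 ▸ 202738 ▸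
  261075 ▸ 202336 ▸ 142374 ▸ 291083 ▸ 271566 ▸ 232746 ▸ 212364 ▸ 192627 ▸ 192544 ▸ 251845 ▸
  141774 ▸ 291584 ▸ 281655 ▸ 211863 ▸ 162855 ▸ 202275 ▸ 133227 ▸ 242037 ▸ 281473 ▸ 291766 ▸
  221974 ▸ 172663 ▸ 152265 ▸ 212083 ▸ 183237 ▸ 281974 ▸ 162574 ▸ 281374 ▸ 261574 ▸ 193045 ▸
  301855 ▸ 292047 ▸ 212065 ▸ 311065 ▸ 192546 ▸ 281936 ▸ 301255 ▸ 261556 ▸ 162075 ▸ 222154 ▸
  172164 ▸ 192047 ▸ 192045 ▸ 242556 ▸ 281336 ▸ 251764 ▸ 231946 ▸ 162356 ▸ 242057 ▸ 181956 ▸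
  242055 ▸ 231845 ▸ 251865 ▸ 182237 ▸ 192067 ▸ 241556 ▸ 172445 ▸ 202156 ▸ 191566 ▸ 171946 ▸
  251665 ▸ 201655 ▸ 191865 ▸ 201675 ▸ 191366 ▸ 151665 ▸ stuck 201174 ∷ 151946 ▸ 162437 ▸
  192065 ▸ 261455 ▸ 152447 ▸ 222437 ▸ 181954 ▸ 251465 ▸ 192566 ▸ 251663 ▸ 202457 ▸ 172146 ▸
  182455 ▸ 201873 ▸ 201653 ▸ 201857 ▸ 172344 ▸ 172647 ▸ 202253 ▸ 211665 ▸ 222156 ▸ 201752 ▸
  231546 ▸ 191746 ▸ 221754 ▸ 212364 ▸ 231865 ▸ 201835 ▸ 232245 ▸ 162855 ▸ 241657 ▸ 251746 ▸
  211643 ▸ 172245 ▸ 242356 ▸ 182736 ▸ 271665 ▸ 162134 ▸ 192346 ▸ 122736 ▸ 221655 ▸ 261576 ▸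
  162635 ▸ 132346 ▸ 182136 ▸ 241536 ▸ 211566 ▸ 163136 ▸ 132847 ▸ 191944 ▸ 143255 ▸ 152766 ▸
  132544 ▸ 192544 ▸ 162574 ▸ 192045 ▸ 133144 ▸ 212065 ▸ 132645 ▸ 212564 ▸ stuck 192645 ∷ []) ∷
  191663 ▸ 212144 ▸ 192764 ▸ 251663 ▸ 142154 ▸ 202556 ▸ 201653 ▸ 252263 ▸ 201554 ▸ 142556 ▸
  202253 ▸ 242174 ▸ 241673 ▸ 192665 ▸ 192065 ▸ 251465 ▸ 192566 ▸ 251966 ▸ 202457 ▸
  split 201774 (202374 ▸ 182455 ▸ 162536 ▸ 152744 ▸ 221936 ▸ 172647 ▸ 132863 ▸ 212744 ▸
  232047 ▸ 212166 ▸ 241855 ▸ 222255 ▸ 211566 ▸ 221974 ▸ 242136 ▸ 212463 ▸ 162574 ▸ 202352 ▸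
  212065 ▸ 201752 ▸ 192146 ▸ 212564 ▸ 142352 ▸ 192645 ▸ 201954 ▸ 142952 ▸ 202453 ▸ stuck 202952
  ∷ 191966 ▸ 202374 ▸ 181855 ▸ 191465 ▸ 132566 ▸ 182455 ▸ 222255 ▸ 161936 ▸ 132065 ▸ 152447 ▸
  232063 ▸ 212463 ▸ 171744 ▸ 182075 ▸ 151946 ▸ 211847 ▸ 151847 ▸ 221754 ▸ 242075 ▸ 162035 ▸
  211346 ▸ 212447 ▸ 231964 ▸ 211946 ▸ 221435 ▸ 202336 ▸ 261956 ▸ 201857 ▸ 261455 ▸ 201736 ▸
  192247 ▸ 251845 ▸ 271764 ▸ 211665 ▸ 191647 ▸ 212364 ▸ 231546 ▸ 161655 ▸ 192445 ▸ 172146 ▸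
  241354 ▸ 181536 ▸ 171766 ▸ 191944 ▸ 161974 ▸ 152265 ▸ 191845 ▸ 122136 ▸ 172063 ▸ 211964 ▸
  142336 ▸ 102255 ▸ 132247 ▸ 172663 ▸ 221756 ▸ 162255 ▸ 112366 ▸ 221655 ▸ 162356 ▸ 152245 ▸
  stuck 172164 ∷ 191966 ▸ 181855 ▸ 182174 ▸ 161936 ▸ 182455 ▸ 241574 ▸ 171744 ▸ 202374 ▸
  242075 ▸ 222255 ▸ 231964 ▸ 182675 ▸ 172245 ▸ 222156 ▸ 192467 ▸ 202275 ▸ stuck 182356 ∷ []) ∷
  191663 ▸ 142154 ▸ 211544 ▸ 201554 ▸ stuck 261554 ∷ []) ∷ 142154 ▸ 252164 ▸ 191663 ▸ 201554 ▸
  152045 ▸ split 142253 (141653 ▸ 142754 ▸ 201653 ▸ 152546 ▸ 192263 ▸ 202253 ▸ 251663 ▸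
  151946 ▸ 191762 ▸ 251063 ▸ 162035 ▸ 251162 ▸ 251564 ▸ 191564 ▸ 261653 ▸ 192065 ▸ 211643 ▸
  181954 ▸ 251465 ▸ 191465 ▸ 241354 ▸ 211346 ▸ stuck 221435 ∷ 141653 ▸ 202253 ▸ stuck 201653 ∷
  132164 ▸ 191564 ▸ 141554 ▸ 251564 ▸ 82154 ▸ 250964 ▸ 251063 ▸ 82655 ▸ 251465 ▸ 251663 ▸
  251966 ▸ 252065 ▸ 261455 ▸ 192263 ▸ 192065 ▸ 202556 ▸ 261956 ▸ 260855 ▸ 132263 ▸ 142754 ▸
  241574 ▸ 152546 ▸ 142556 ▸ 192764 ▸ 252566 ▸ 152144 ▸ 143255 ▸ 251366 ▸ 240974 ▸ 211946 ▸
  102536 ▸ 152645 ▸ 192566 ▸ 212546 ▸ 83255 ▸ 161936 ▸ 212645 ▸ 212447 ▸ 191966 ▸ 242075 ▸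
  162536 ▸ 271946 ▸ 211445 ▸ 103136 ▸ 241475 ▸ 181855 ▸ 182455 ▸ 221936 ▸ 272447 ▸ 172047 ▸
  171744 ▸ 172344 ▸ 132445 ▸ 231964 ▸ 241855 ▸ 222437 ▸ 221556 ▸ 112344 ▸ 231744 ▸ 152364 ▸
  261774 ▸ 242356 ▸ 112944 ▸ 232245 ▸ 151863 ▸ 261174 ▸ 271566 ▸ 241756 ▸ 92463 ▸ 251867 ▸
  251845 ▸ 93063 ▸ 261675 ▸ 202336 ▸ 242037 ▸ 201675 ▸ 192544 ▸ 241536 ▸ 152166 ▸ 142554 ▸
  251647 ▸ 192045 ▸ stuck 202156 ∷ []) ∷ []) ∷ 212045 ▸ split 192065 (251465 ▸ 142556 ▸
  251966 ▸ 202556 ▸ 192566 ▸ 252566 ▸ 252065 ▸ 192665 ▸ 202457 ▸ 242174 ▸ 241673 ▸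
  split 251366 (191966 ▸ 141956 ▸ 201356 ▸ 142457 ▸ stuck 201857 ∷ 201857 ▸ 191966 ▸ 241574 ▸
  191465 ▸ 182174 ▸ 191564 ▸ 242075 ▸ 132164 ▸ 241475 ▸ 182075 ▸ 152045 ▸ 241976 ▸ 132065 ▸
  152645 ▸ 261857 ▸ 142154 ▸ 131564 ▸ 151946 ▸ 202154 ▸ 181574 ▸ 152447 ▸ 201554 ▸ 152144 ▸
  231584 ▸ 211847 ▸ 291584 ▸ 211544 ▸ 211665 ▸ 221655 ▸ stuck 271665 ∷ 201857 ▸ 261455 ▸
  261857 ▸ 241574 ▸ 191564 ▸ 182174 ▸ 242075 ▸ 132164 ▸ 191966 ▸ 302075 ▸ 152045 ▸ 132665 ▸
  301574 ▸ 152645 ▸ 152546 ▸ 142457 ▸ 251564 ▸ 211946 ▸ 192467 ▸ 252164 ▸ 252467 ▸ 162437 ▸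
  212348 ▸ 192764 ▸ 182356 ▸ 212645 ▸ 242356 ▸ stuck 222437 ∷ []) ∷ 191564 ▸ 142556 ▸ 192566 ▸
  split 182174 (132164 ▸ 191966 ▸ 182774 ▸ 141956 ▸ 251966 ▸ 132566 ▸ 152045 ▸ 251465 ▸
  152447 ▸ 152645 ▸ 250964 ▸ 252065 ▸ 202457 ▸ 151946 ▸ 132764 ▸ 192665 ▸ 151445 ▸ 182273 ▸
  143156 ▸ 182576 ▸ 242174 ▸ 152948 ▸ 241673 ▸ 242273 ▸ 232184 ▸ split 181574 (131564 ▸
  191366 ▸ 122174 ▸ 241574 ▸ 231584 ▸ 190964 ▸ 251366 ▸ 141356 ▸ 131966 ▸ 122774 ▸ 172184 ▸
  261455 ▸ 241073 ▸ 242075 ▸ 201356 ▸ 181976 ▸ 211946 ▸ 181673 ▸ 182675 ▸ 291584 ▸ 181475 ▸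
  261956 ▸ 162437 ▸ 152546 ▸ 171865 ▸ 231683 ▸ 162756 ▸ 231485 ▸ 261356 ▸ 212447 ▸ 202556 ▸
  252164 ▸ 172465 ▸ 221875 ▸ 260855 ▸ 142837 ▸ 221693 ▸ 261857 ▸ 202154 ▸ 272045 ▸ 301673 ▸
  162354 ▸ 231865 ▸ 211764 ▸ 221374 ▸ 192346 ▸ 311366 ▸ 152144 ▸ 212265 ▸ 261554 ▸ 251663 ▸
  301073 ▸ 212364 ▸ 201653 ▸ 211566 ▸ 182257 ▸ 182235 ▸ 191845 ▸ 311966 ▸ 271665 ▸ 261774 ▸
  241855 ▸ 271544 ▸ 251063 ▸ 261053 ▸ 232245 ▸ 142336 ▸ 292085 ▸ 251746 ▸ 212144 ▸ 261174 ▸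
  201053 ▸ 231744 ▸ 132247 ▸ 272166 ▸ 202237 ▸ 222255 ▸ 201774 ▸ 141653 ▸ 191647 ▸ 252247 ▸
  181855 ▸ 142253 ▸ 242136 ▸ 161936 ▸ 202253 ▸ 192146 ▸ 162536 ▸ 202754 ▸ 222536 ▸ 182873 ▸
  232344 ▸ 132863 ▸ stuck 182354 ∷ 132065 ▸ 182075 ▸ 191663 ▸ 241574 ▸ 142154 ▸ 191465 ▸
  132665 ▸ 211544 ▸ 192263 ▸ 241172 ▸ 241073 ▸ 201554 ▸ 241475 ▸ 152144 ▸ 261554 ▸ 192764 ▸
  251663 ▸ 252263 ▸ 260954 ▸ 162255 ▸ 212144 ▸ 142754 ▸ 231782 ▸ 251762 ▸ 211445 ▸ 172366 ▸
  222255 ▸ 202754 ▸ 201752 ▸ 231364 ▸ 232063 ▸ 182873 ▸ 211863 ▸ 191944 ▸ 181855 ▸ 132863 ▸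
  152463 ▸ 201736 ▸ 251944 ▸ 171766 ▸ 172344 ▸ 201954 ▸ 191647 ▸ 232344 ▸ 192146 ▸ stuck 182354
  ∷ 191366 ▸ 132065 ▸ 122174 ▸ 191663 ▸ 142154 ▸ 182075 ▸ 132263 ▸ 192263 ▸ 162035 ▸ 202154 ▸
  232085 ▸ 181772 ▸ 192863 ▸ 152144 ▸ 212265 ▸ 251663 ▸ 171964 ▸ 192362 ▸ 162255 ▸ 211544 ▸
  192346 ▸ 201653 ▸ 252164 ▸ 231782 ▸ 122455 ▸ 161853 ▸ 172063 ▸ 142336 ▸ 172366 ▸ 161534 ▸
  241855 ▸ 211764 ▸ 221974 ▸ 142374 ▸ 211863 ▸ 132247 ▸ 212166 ▸ 172465 ▸ 232063 ▸ 191865 ▸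
  152463 ▸ 192364 ▸ 231744 ▸ 181756 ▸ 152166 ▸ 162354 ▸ 182554 ▸ 251944 ▸ 141875 ▸ 182073 ▸
  142873 ▸ 242354 ▸ 202156 ▸ 172047 ▸ 161754 ▸ 182235 ▸ 182053 ▸ 201954 ▸ 202453 ▸ 231564 ▸
  152665 ▸ 171865 ▸ 141835 ▸ 232245 ▸ 151964 ▸ 251445 ▸ 212245 ▸ 131746 ▸ 172245 ▸ 161756 ▸
  241653 ▸ 211746 ▸ 162754 ▸ 181255 ▸ 222255 ▸ 211247 ▸ 172546 ▸ 181754 ▸ 232047 ▸ 162855 ▸
  221336 ▸ 171946 ▸ 221936 ▸ 172663 ▸ 171845 ▸ 162154 ▸ 172164 ▸ 172445 ▸ 121855 ▸ 211645 ▸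
  222154 ▸ 171346 ▸ 221756 ▸ 221554 ▸ 231845 ▸ 201635 ▸ 231346 ▸ 202134 ▸ 231946 ▸ 192045 ▸
  221835 ▸ 241754 ▸ 192544 ▸ 172344 ▸ 191944 ▸ 242053 ▸ 232344 ▸ 201752 ▸ 182354 ▸ 202253 ▸
  181855 ▸ 222134 ▸ 161936 ▸ 221534 ▸ stuck 211445 ∷ []) ∷ 132164 ▸ 241574 ▸ 191966 ▸ 242174 ▸
  141956 ▸ 152045 ▸ 181574 ▸ 242075 ▸ 192665 ▸ 152645 ▸ 191663 ▸ 182075 ▸ 252065 ▸ 142154 ▸
  241673 ▸ 202154 ▸ 152144 ▸ 261554 ▸ 211544 ▸ 162035 ▸ split 211764 (162255 ▸ 172063 ▸
  181855 ▸ 161974 ▸ 171782 ▸ 151863 ▸ 211263 ▸ 161754 ▸ 211863 ▸ 181673 ▸ 191944 ▸ 201752 ▸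
  191465 ▸ 182136 ▸ 201736 ▸ 202253 ▸ 241475 ▸ 201653 ▸ 202754 ▸ 241976 ▸ 191845 ▸ 212546 ▸
  231865 ▸ 202457 ▸ 251746 ▸ 221754 ▸ 241954 ▸ 261857 ▸ 192346 ▸ 162354 ▸ 211946 ▸ 222255 ▸
  201873 ▸ 271665 ▸ 182554 ▸ 161853 ▸ 222035 ▸ 261455 ▸ 242136 ▸ 212463 ▸ 261873 ▸ 211665 ▸
  171964 ▸ 162635 ▸ 211964 ▸ 232344 ▸ 212364 ▸ 162156 ▸ 212645 ▸ 162473 ▸ 261954 ▸ 222156 ▸
  162855 ▸ 212166 ▸ 262655 ▸ 182354 ▸ 172647 ▸ 192247 ▸ 192146 ▸ 182736 ▸ 252146 ▸ 242736 ▸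
  stuck 192746 ∷ 162255 ▸ 201653 ▸ 172063 ▸ 152447 ▸ 191845 ▸ 211847 ▸ 142336 ▸ 132566 ▸
  201736 ▸ 131966 ▸ 122774 ▸ 221655 ▸ 191944 ▸ 231766 ▸ 181855 ▸ 222255 ▸ 211863 ▸ 191647 ▸
  161936 ▸ 171766 ▸ 161974 ▸ 152463 ▸ 221936 ▸ 151847 ▸ 172265 ▸ 152166 ▸ 221974 ▸ 221336 ▸
  211247 ▸ 221756 ▸ 192146 ▸ 142374 ▸ 241855 ▸ 201954 ▸ 191366 ▸ 161756 ▸ 142156 ▸ 191865 ▸
  151964 ▸ 212065 ▸ 241356 ▸ 171845 ▸ 162075 ▸ stuck 181956 ∷ 201653 ▸ 202253 ▸ 141653 ▸
  202754 ▸ 142253 ▸ stuck 142754 ∷ []) ∷ 242174 ▸ 251966 ▸ 192665 ▸ 251465 ▸ stuck 252065 ∷ [])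
  ∷ 191564 ▸ 192665 ▸ 252065 ▸ 242174 ▸ 202556 ▸ split 152645 (202154 ▸ 152144 ▸ 252164 ▸
  211544 ▸ 251564 ▸ 261554 ▸ stuck 201554 ∷ 142556 ▸ 152045 ▸ 202154 ▸ 192566 ▸ 132164 ▸
  152546 ▸ 211445 ▸ 152144 ▸ 261554 ▸ 182774 ▸ 132764 ▸ 182174 ▸ 211946 ▸ 132665 ▸ 161936 ▸
  201653 ▸ 211544 ▸ 262154 ▸ 192764 ▸ 151946 ▸ 162437 ▸ 261455 ▸ 182675 ▸ 212144 ▸ 252164 ▸
  152447 ▸ 212447 ▸ 251663 ▸ 251564 ▸ 162255 ▸ 261956 ▸ 222255 ▸ 201554 ▸ 301574 ▸ 211764 ▸
  172063 ▸ 142336 ▸ 162756 ▸ 172366 ▸ 202336 ▸ 232366 ▸ 211346 ▸ 241574 ▸ 191845 ▸ 172564 ▸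
  212265 ▸ 182356 ▸ 172966 ▸ 211847 ▸ 231766 ▸ 251845 ▸ 222574 ▸ 192346 ▸ 181756 ▸ 221655 ▸
  241855 ▸ 132247 ▸ 231463 ▸ 181855 ▸ 221936 ▸ 251344 ▸ 182455 ▸ 192247 ▸ 122455 ▸ 123055 ▸
  192263 ▸ 242455 ▸ 251647 ▸ 212128 ▸ 132566 ▸ 202374 ▸ 183055 ▸ 252247 ▸ 241536 ▸ 232047 ▸
  212463 ▸ 242136 ▸ 182556 ▸ 192544 ▸ 192645 ▸ stuck 192045 ∷ 152045 ▸ 152546 ▸ 212546 ▸
  202457 ▸ 153146 ▸ 262556 ▸ 203156 ▸ 252665 ▸ 252164 ▸ 261956 ▸ 202154 ▸ 192764 ▸ 262457 ▸
  242075 ▸ 261554 ▸ 241574 ▸ 182075 ▸ 262154 ▸ 182675 ▸ 271946 ▸ 132665 ▸ 261857 ▸ 182174 ▸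
  232184 ▸ 291584 ▸ 212265 ▸ stuck 271665 ∷ []) ∷ []) ∷ []) ∷ split 201956 (212045 ▸
  split 201554 (152045 ▸ 251564 ▸ split 192065 (191564 ▸ 202154 ▸ 192665 ▸ 211445 ▸ 142154 ▸
  242174 ▸ 201653 ▸ 151445 ▸ 92645 ▸ 191663 ▸ 151946 ▸ 241673 ▸ 211946 ▸ 162035 ▸ 152447 ▸
  182273 ▸ 161936 ▸ 152546 ▸ 212447 ▸ 162437 ▸ 221837 ▸ split 172427 (222437 ▸ 112427 ▸
  171827 ▸ 92546 ▸ 93146 ▸ 143156 ▸ 163037 ▸ 152948 ▸ 202457 ▸ 192346 ▸ 191746 ▸ 132346 ▸
  181635 ▸ stuck 122235 ∷ 221936 ▸ 112427 ▸ 211847 ▸ 221336 ▸ 271445 ▸ 92546 ▸ 171827 ▸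
  261356 ▸ 211544 ▸ 261653 ▸ 142556 ▸ 261956 ▸ 201356 ▸ 192566 ▸ 261455 ▸ 201857 ▸ 241574 ▸
  191746 ▸ 202358 ▸ 221655 ▸ 211665 ▸ 241756 ▸ 181635 ▸ 192247 ▸ 231766 ▸ 201736 ▸ 231463 ▸
  251845 ▸ 182235 ▸ 182136 ▸ 212166 ▸ 172366 ▸ 202336 ▸ 241255 ▸ 191845 ▸ 271764 ▸ 162354 ▸
  182736 ▸ 241536 ▸ 211566 ▸ 182455 ▸ 231144 ▸ 251344 ▸ 211764 ▸ 181756 ▸ 221754 ▸ 152265 ▸
  231447 ▸ 231744 ▸ 192544 ▸ 202374 ▸ 162574 ▸ 191344 ▸ 162255 ▸ 171744 ▸ 201774 ▸ 192045 ▸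
  212065 ▸ 181255 ▸ 181536 ▸ 181855 ▸ 142374 ▸ 191546 ▸ 231946 ▸ 171447 ▸ 241855 ▸ 181754 ▸
  171946 ▸ stuck 191865 ∷ 221936 ▸ 211847 ▸ 271847 ▸ 261356 ▸ 251966 ▸ 251465 ▸ 202457 ▸
  192346 ▸ 172465 ▸ 241855 ▸ 212265 ▸ 162354 ▸ 182554 ▸ 232047 ▸ 191845 ▸ 221974 ▸ 181954 ▸
  211764 ▸ 142336 ▸ 172146 ▸ 191746 ▸ 171865 ▸ 161754 ▸ 182257 ▸ 231546 ▸ 241756 ▸ 201857 ▸
  181673 ▸ 162255 ▸ 202138 ▸ 202176 ▸ 231645 ▸ 241255 ▸ 211665 ▸ 261857 ▸ 201356 ▸ 132164 ▸
  122273 ▸ 152144 ▸ 201637 ▸ 152166 ▸ 221556 ▸ 221237 ▸ 82655 ▸ 72764 ▸ 132263 ▸ 211748 ▸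
  212166 ▸ 162156 ▸ 172047 ▸ 161837 ▸ 231045 ▸ 122455 ▸ 181772 ▸ 261257 ▸ 192247 ▸ 182037 ▸
  181855 ▸ 102437 ▸ 132544 ▸ 161853 ▸ 261758 ▸ 202336 ▸ 182136 ▸ 181536 ▸ 161974 ▸ 82556 ▸
  112344 ▸ 211863 ▸ 251647 ▸ 192544 ▸ 82055 ▸ 151863 ▸ 191944 ▸ 202156 ▸ 132045 ▸ 92463 ▸
  192045 ▸ 82554 ▸ 142554 ▸ stuck 141954 ∷ []) ∷ 191564 ▸ 142556 ▸ 252065 ▸ 211445 ▸ 141554 ▸
  141956 ▸ 192566 ▸ 202556 ▸ 142154 ▸ 132164 ▸ 152546 ▸ 252566 ▸ 92645 ▸ 202154 ▸ 191663 ▸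
  151946 ▸ 262655 ▸ 201653 ▸ 211946 ▸ 162035 ▸ 212645 ▸ 262154 ▸ 141653 ▸ 212546 ▸ 211346 ▸
  212144 ▸ 142253 ▸ 162536 ▸ 161837 ▸ 162134 ▸ 112526 ▸ 171926 ▸ 132445 ▸ stuck 191845 ∷
  142556 ▸ 202154 ▸ stuck 152645 ∷ []) ∷ 152045 ▸ 261554 ▸ 152645 ▸ 211544 ▸ split 211946 (
  212546 ▸ 211445 ▸ 162536 ▸ 152546 ▸ 261455 ▸ 162035 ▸ 151946 ▸ 102536 ▸ 153146 ▸ 152447 ▸
  103136 ▸ 212447 ▸ 202457 ▸ 102635 ▸ 222536 ▸ 261956 ▸ 211847 ▸ 162635 ▸ 202556 ▸ 221936 ▸
  142556 ▸ 271946 ▸ 172427 ▸ 212144 ▸ 192065 ▸ 162437 ▸ 132764 ▸ 141956 ▸ 192566 ▸ 261857 ▸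
  252065 ▸ 173027 ▸ 202154 ▸ 142457 ▸ 182774 ▸ 162938 ▸ 192346 ▸ 132665 ▸ 242174 ▸ 222338 ▸
  212265 ▸ 182174 ▸ 222255 ▸ 191966 ▸ 172746 ▸ 241976 ▸ 232146 ▸ stuck 222057 ∷ 202154 ▸
  142154 ▸ 192065 ▸ 152144 ▸ 162035 ▸ 191663 ▸ 192665 ▸ 212144 ▸ 132263 ▸ 241673 ▸ 242174 ▸
  182273 ▸ split 172427 (162635 ▸ 162134 ▸ 152546 ▸ 222035 ▸ 161534 ▸ 151946 ▸ 271544 ▸
  151445 ▸ 221534 ▸ stuck 211445 ∷ 221936 ▸ 162536 ▸ 212546 ▸ 161936 ▸ 152546 ▸ 202457 ▸
  162437 ▸ 102536 ▸ 151946 ▸ 153146 ▸ 221837 ▸ 112427 ▸ 152447 ▸ 103136 ▸ 92546 ▸ 172328 ▸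
  212447 ▸ 211847 ▸ 102635 ▸ 142556 ▸ 162938 ▸ 162635 ▸ 192566 ▸ 222338 ▸ 222035 ▸ 232427 ▸
  162338 ▸ 182417 ▸ 281936 ▸ 172146 ▸ 202336 ▸ 231926 ▸ 232146 ▸ 221655 ▸ 182257 ▸ 172647 ▸
  192528 ▸ 222255 ▸ 182136 ▸ 172746 ▸ 162255 ▸ 172465 ▸ 222156 ▸ 192346 ▸ 122736 ▸ 182857 ▸
  242037 ▸ 162756 ▸ 172245 ▸ 182637 ▸ 182356 ▸ 182037 ▸ 172564 ▸ 191845 ▸ stuck 171964 ∷
  162635 ▸ 152546 ▸ 221936 ▸ 162134 ▸ 222035 ▸ 151946 ▸ 152447 ▸ 212447 ▸ 211847 ▸ 222536 ▸
  271847 ▸ 172526 ▸ 251966 ▸ 162734 ▸ 251465 ▸ 202457 ▸ 191465 ▸ 192346 ▸ 191966 ▸ 142336 ▸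
  172465 ▸ 241855 ▸ 212265 ▸ 192566 ▸ 202336 ▸ 162255 ▸ 162354 ▸ 182554 ▸ 122455 ▸ 191845 ▸
  142556 ▸ 182774 ▸ 222255 ▸ 181954 ▸ 172746 ▸ 132544 ▸ 211764 ▸ 132764 ▸ 221754 ▸ 162855 ▸
  191746 ▸ 171865 ▸ 131944 ▸ 192544 ▸ 142853 ▸ 172245 ▸ 222354 ▸ 212364 ▸ 231865 ▸ 191944 ▸
  251746 ▸ 202473 ▸ 152364 ▸ 172063 ▸ 201736 ▸ 152964 ▸ 181855 ▸ 162756 ▸ 161974 ▸ 172564 ▸
  stuck 162475 ∷ 152546 ▸ 142754 ▸ stuck 132665 ∷ []) ∷ 151946 ▸ stuck 152546 ∷ 151946 ▸
  stuck 152546 ∷ []) ∷ 142154 ▸ 251564 ▸ 141554 ▸ 202154 ▸ 191663 ▸ 152645 ▸ 152144 ▸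
  split 142253 (201653 ▸ 202253 ▸ 141653 ▸ 151643 ▸ 92144 ▸ 201053 ▸ 251063 ▸ 92744 ▸ 92645 ▸
  151544 ▸ 191063 ▸ 92045 ▸ 93245 ▸ 152045 ▸ 191564 ▸ 131663 ▸ 142754 ▸ 151445 ▸ 192065 ▸
  132164 ▸ 152546 ▸ 143255 ▸ 151946 ▸ 181673 ▸ 132764 ▸ 192764 ▸ 211946 ▸ 241673 ▸ 182273 ▸
  212645 ▸ 212144 ▸ 211643 ▸ 152243 ▸ 221754 ▸ stuck 162354 ∷ 141653 ▸ 202253 ▸ stuck 201653 ∷
  142754 ▸ 192263 ▸ 143255 ▸ stuck 192764 ∷ 142754 ▸ 192263 ▸ 212144 ▸ 152744 ▸ 162536 ▸
  202754 ▸ 212546 ▸ stuck 192665 ∷ []) ∷ []) ∷ 212045 ▸ split 252065 (202556 ▸ 251564 ▸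
  split 202154 (142154 ▸ 192065 ▸ 252164 ▸ 191663 ▸ 192665 ▸ 261956 ▸ 143156 ▸ 242174 ▸
  252665 ▸ 262556 ▸ 242075 ▸ 241673 ▸ 212546 ▸ 182273 ▸ 211946 ▸ 162536 ▸ 202457 ▸ 212447 ▸
  152546 ▸ 161936 ▸ 262457 ▸ 162437 ▸ 221837 ▸ split 212348 (222437 ▸ 152948 ▸ 212948 ▸
  271946 ▸ 281837 ▸ 212645 ▸ 152447 ▸ 272348 ▸ 162938 ▸ 203156 ▸ 272546 ▸ 272045 ▸ 152645 ▸
  172328 ▸ 153047 ▸ 252467 ▸ 222338 ▸ 153146 ▸ 223037 ▸ 222536 ▸ 222035 ▸ 152144 ▸ 162035 ▸
  172928 ▸ 251966 ▸ 242356 ▸ 202958 ▸ 173027 ▸ 172526 ▸ 232146 ▸ 162635 ▸ 172025 ▸ 192346 ▸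
  192847 ▸ 172146 ▸ 163235 ▸ 182136 ▸ 142336 ▸ 192247 ▸ 212766 ▸ 162338 ▸ 162734 ▸ 191944 ▸
  162255 ▸ 162756 ▸ 172427 ▸ 182257 ▸ 162233 ▸ 222156 ▸ 221936 ▸ 202138 ▸ 132247 ▸ 241855 ▸
  172344 ▸ 272166 ▸ 251944 ▸ 271445 ▸ 152166 ▸ 251647 ▸ 152463 ▸ 252247 ▸ 212166 ▸ 321455 ▸
  202156 ▸ 201954 ▸ 311647 ▸ 251445 ▸ 262156 ▸ stuck 261556 ∷ 211847 ▸ 152447 ▸ 162338 ▸
  221936 ▸ 151946 ▸ 172427 ▸ 162035 ▸ 192346 ▸ 172146 ▸ 182235 ▸ 182257 ▸ 162354 ▸ stuck 172465
  ∷ 222437 ▸ 261857 ▸ 222156 ▸ 271946 ▸ 201857 ▸ 202237 ▸ 231964 ▸ 262154 ▸ 142457 ▸ 261554 ▸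
  192467 ▸ 251746 ▸ 271665 ▸ 212265 ▸ 192346 ▸ 172427 ▸ 242356 ▸ 221936 ▸ 162338 ▸ 232245 ▸
  182356 ▸ 271445 ▸ 172146 ▸ 231645 ▸ 241756 ▸ 192148 ▸ 202275 ▸ 261653 ▸ 232146 ▸ 221655 ▸
  172647 ▸ 251845 ▸ 252148 ▸ 152766 ▸ 222035 ▸ 201736 ▸ 281655 ▸ 191845 ▸ 212766 ▸ 272045 ▸
  202336 ▸ 241855 ▸ 262253 ▸ 261736 ▸ 222255 ▸ 251647 ▸ 232047 ▸ 172047 ▸ 232647 ▸ 162255 ▸
  152166 ▸ 222536 ▸ 202156 ▸ 212744 ▸ stuck 212245 ∷ []) ∷ 152645 ▸ 201554 ▸ 252164 ▸ 152144 ▸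
  212645 ▸ 152045 ▸ 261956 ▸ 252665 ▸ 192764 ▸ 152546 ▸ 151544 ▸ 192665 ▸ 143255 ▸ 212546 ▸
  141455 ▸ 192065 ▸ 143156 ▸ 142754 ▸ 211946 ▸ 202457 ▸ 141956 ▸ 191465 ▸ 242075 ▸ 132665 ▸
  151946 ▸ 271946 ▸ 191966 ▸ 182675 ▸ 152447 ▸ 222437 ▸ 192467 ▸ 152948 ▸ 212348 ▸ 162756 ▸
  stuck 222156 ∷ 152645 ▸ 192065 ▸ stuck 142556 ∷ []) ∷ 251465 ▸ 202556 ▸ 251966 ▸ 142556 ▸
  split 211946 (261956 ▸ 151946 ▸ 261455 ▸ 152546 ▸ 152447 ▸ 212546 ▸ 202457 ▸ 162536 ▸
  161936 ▸ 162035 ▸ 221936 ▸ 211445 ▸ 151847 ▸ 152045 ▸ 211847 ▸ 201857 ▸ 152645 ▸ 212447 ▸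
  211346 ▸ 191966 ▸ 142457 ▸ 152144 ▸ 132764 ▸ 202154 ▸ 212645 ▸ 271847 ▸ 201554 ▸ 221435 ▸
  162338 ▸ 132263 ▸ 192065 ▸ 162635 ▸ 271247 ▸ 191663 ▸ 172146 ▸ 142754 ▸ 211247 ▸ 142154 ▸
  181855 ▸ 181954 ▸ 192263 ▸ 221336 ▸ 132346 ▸ 212144 ▸ 171827 ▸ 211643 ▸ 191746 ▸ stuck 201835
  ∷ 192065 ▸ 192566 ▸ 202154 ▸ 192665 ▸ 191966 ▸ 142154 ▸ 202457 ▸ 242174 ▸ 191663 ▸ 241673 ▸
  182774 ▸ 182273 ▸ split 221936 (211847 ▸ 152447 ▸ 212447 ▸ 151946 ▸ 271847 ▸ 222536 ▸
  162437 ▸ 153047 ▸ 152546 ▸ 162035 ▸ 212546 ▸ 92546 ▸ 162536 ▸ 222338 ▸ 161936 ▸ 163136 ▸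
  112427 ▸ 171827 ▸ 172427 ▸ 162635 ▸ 192346 ▸ 102635 ▸ 182235 ▸ 241855 ▸ 212265 ▸ 103136 ▸
  162354 ▸ 232047 ▸ 182455 ▸ 153146 ▸ 172146 ▸ 172465 ▸ 181954 ▸ 181855 ▸ 172647 ▸ 152645 ▸
  231546 ▸ 182257 ▸ 171865 ▸ 152144 ▸ 232146 ▸ 202176 ▸ 172366 ▸ 161754 ▸ 162255 ▸ 142336 ▸
  222057 ▸ 211764 ▸ 152166 ▸ 191845 ▸ 222657 ▸ 221875 ▸ 161974 ▸ 132445 ▸ 222156 ▸ 162475 ▸
  212364 ▸ stuck 152364 ∷ 162536 ▸ 211847 ▸ 212546 ▸ 161936 ▸ 152546 ▸ 221336 ▸ 271346 ▸
  211544 ▸ 221837 ▸ 261554 ▸ 162035 ▸ 262154 ▸ 212144 ▸ 202754 ▸ 152144 ▸ 212645 ▸ 182873 ▸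
  152645 ▸ 162635 ▸ 162437 ▸ 102635 ▸ 172427 ▸ 163136 ▸ 222536 ▸ 103136 ▸ 212447 ▸ 281936 ▸
  212744 ▸ 153146 ▸ 271847 ▸ 232427 ▸ 231926 ▸ 192863 ▸ 162938 ▸ 222338 ▸ 182417 ▸ 192362 ▸
  162338 ▸ 172146 ▸ 142457 ▸ 162354 ▸ 232146 ▸ 181954 ▸ 221655 ▸ 182257 ▸ 172647 ▸ 152265 ▸
  172465 ▸ 182455 ▸ 182554 ▸ 201736 ▸ 281655 ▸ 232647 ▸ 162855 ▸ 192528 ▸ 172047 ▸ 132346 ▸
  202336 ▸ 172746 ▸ 182736 ▸ 232047 ▸ 192544 ▸ 142336 ▸ 192225 ▸ 182857 ▸ 222255 ▸ 192043 ▸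
  132225 ▸ 182356 ▸ 173065 ▸ 212463 ▸ 132726 ▸ 172564 ▸ 142534 ▸ stuck 162453 ∷ 162536 ▸
  212546 ▸ 152447 ▸ 152546 ▸ stuck 151946 ∷ []) ∷ 212546 ▸ stuck 152546 ∷ 212546 ▸ stuck 152546
  ∷ []) ∷ 251564 ▸ 192665 ▸ 192065 ▸ 242174 ▸ 252665 ▸ 142556 ▸ 192566 ▸ split 261956 (
  261356 ▸ 212447 ▸ 242075 ▸ 252164 ▸ 271445 ▸ 211847 ▸ 241574 ▸ 202154 ▸ 301574 ▸ 142154 ▸
  321455 ▸ 191663 ▸ 201554 ▸ 241673 ▸ 251063 ▸ 261554 ▸ 260855 ▸ 301073 ▸ 211544 ▸ 301673 ▸
  221655 ▸ 162035 ▸ 311465 ▸ 251663 ▸ 242273 ▸ 310865 ▸ 321554 ▸ 192764 ▸ 311366 ▸ 271544 ▸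
  202556 ▸ 261857 ▸ 222035 ▸ 281655 ▸ 262556 ▸ 271665 ▸ 232146 ▸ 212546 ▸ 212265 ▸ stuck 222354
  ∷ 212447 ▸ 202556 ▸ 152447 ▸ 143156 ▸ 162536 ▸ 202457 ▸ 203156 ▸ 212546 ▸ 152948 ▸ 262556 ▸
  163037 ▸ stuck 213047 ∷ 261455 ▸ 242075 ▸ 211946 ▸ 252164 ▸ stuck 202154 ∷ []) ∷ []) ∷ []) ∷
  split 201956 (212045 ▸ split 192065 (191564 ▸ 192665 ▸ 251564 ▸ 242174 ▸ split 142154 (
  141554 ▸ 191663 ▸ 201554 ▸ 191063 ▸ 241673 ▸ 202154 ▸ 152045 ▸ 251063 ▸ 182273 ▸ 261554 ▸
  92645 ▸ 211445 ▸ 301073 ▸ 211544 ▸ 201653 ▸ 151445 ▸ 162035 ▸ 201053 ▸ 261053 ▸ 151946 ▸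
  200954 ▸ 161534 ▸ 151544 ▸ 152447 ▸ 250964 ▸ 251465 ▸ 270845 ▸ 241172 ▸ 191465 ▸ 251966 ▸
  221336 ▸ 181772 ▸ 181673 ▸ 202457 ▸ 192566 ▸ 171827 ▸ 241772 ▸ 132164 ▸ 191966 ▸ 142556 ▸
  192263 ▸ 231683 ▸ 82154 ▸ 141956 ▸ 182174 ▸ 191762 ▸ 242273 ▸ 211764 ▸ 131663 ▸ 82556 ▸
  132665 ▸ 181954 ▸ 232184 ▸ 161754 ▸ 132566 ▸ 82655 ▸ 142457 ▸ 172146 ▸ 191746 ▸ 181453 ▸
  231964 ▸ 212265 ▸ 171865 ▸ 182576 ▸ 181635 ▸ 182455 ▸ 231463 ▸ 221853 ▸ 162255 ▸ 261774 ▸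
  172465 ▸ 231645 ▸ 202374 ▸ 221655 ▸ 241255 ▸ 172366 ▸ 271863 ▸ 182257 ▸ 152364 ▸ 161655 ▸
  162574 ▸ 162338 ▸ 172245 ▸ 141736 ▸ 211847 ▸ 182053 ▸ 222255 ▸ 151847 ▸ 261356 ▸ 212144 ▸
  201972 ▸ 232063 ▸ 131966 ▸ 310865 ▸ 152144 ▸ 152463 ▸ 251944 ▸ 250865 ▸ 132263 ▸ 172344 ▸
  201954 ▸ 251366 ▸ 122455 ▸ 142374 ▸ 182136 ▸ 151964 ▸ 251445 ▸ 231447 ▸ 132247 ▸ 141774 ▸
  211566 ▸ 181956 ▸ 241536 ▸ 191647 ▸ 191764 ▸ 231946 ▸ 261556 ▸ 162075 ▸ 192045 ▸ 192146 ▸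
  142273 ▸ 201556 ▸ 172164 ▸ 132645 ▸ 241637 ▸ 222154 ▸ 152564 ▸ 162154 ▸ 162356 ▸ 211645 ▸
  stuck 221756 ∷ 151946 ▸ 191663 ▸ 132065 ▸ 152447 ▸ 211544 ▸ 182075 ▸ 132665 ▸ 181574 ▸
  82655 ▸ 241574 ▸ 132164 ▸ 82055 ▸ 261455 ▸ 182174 ▸ 211445 ▸ 251663 ▸ 122174 ▸ 182675 ▸
  182774 ▸ 202154 ▸ 192566 ▸ 122774 ▸ 201653 ▸ 201554 ▸ 242075 ▸ 142556 ▸ 152045 ▸ 122675 ▸
  92645 ▸ 152645 ▸ 92144 ▸ 152144 ▸ 162255 ▸ 211764 ▸ 172063 ▸ 142336 ▸ 102255 ▸ 162756 ▸
  172366 ▸ 191845 ▸ 172564 ▸ 102756 ▸ 212265 ▸ 112564 ▸ 192346 ▸ 152265 ▸ 162574 ▸ 241855 ▸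
  182455 ▸ 192263 ▸ 132263 ▸ 132863 ▸ 202374 ▸ 131663 ▸ 192863 ▸ 152364 ▸ 142374 ▸ 181673 ▸
  162453 ▸ 201774 ▸ 152463 ▸ 192364 ▸ 231683 ▸ 172245 ▸ 221853 ▸ 181855 ▸ 191966 ▸ 261774 ▸
  172344 ▸ 172382 ▸ 191865 ▸ 221875 ▸ 162156 ▸ 161974 ▸ 132364 ▸ 191944 ▸ 191366 ▸ 271863 ▸
  182136 ▸ 112382 ▸ 171964 ▸ 222156 ▸ 221374 ▸ 152166 ▸ 141875 ▸ 92463 ▸ 161853 ▸ 221655 ▸
  221873 ▸ 202156 ▸ 151964 ▸ 142453 ▸ 211863 ▸ 241536 ▸ 171883 ▸ 162372 ▸ 192045 ▸ 162075 ▸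
  stuck 172164 ∷ []) ∷ 191564 ▸ 142556 ▸ 192566 ▸ split 260954 (261554 ▸ 202154 ▸ 211544 ▸
  142154 ▸ stuck 191663 ∷ 211445 ▸ 152045 ▸ 132164 ▸ stuck 141956 ∷ 261455 ▸ 241574 ▸ 211445 ▸
  242075 ▸ 242174 ▸ 152045 ▸ 192665 ▸ 201554 ▸ 252065 ▸ 143156 ▸ 242675 ▸ 141554 ▸ 251564 ▸
  251465 ▸ 301574 ▸ 200954 ▸ 250964 ▸ 251966 ▸ 241673 ▸ 151445 ▸ 300974 ▸ 202457 ▸ 241073 ▸
  151946 ▸ 301475 ▸ 143057 ▸ 301073 ▸ 152447 ▸ 241475 ▸ 132566 ▸ 152948 ▸ 191465 ▸ 182576 ▸
  141455 ▸ 151544 ▸ split 251366 (250865 ▸ 311366 ▸ 190865 ▸ 310865 ▸ 291485 ▸ 240875 ▸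
  191366 ▸ 261356 ▸ 231485 ▸ 181574 ▸ 241376 ▸ 261956 ▸ 211847 ▸ 232085 ▸ 191663 ▸ 202556 ▸
  241877 ▸ 142154 ▸ 241172 ▸ 202154 ▸ 152546 ▸ 231766 ▸ 142754 ▸ 221655 ▸ 192263 ▸ 222156 ▸
  241772 ▸ stuck 231964 ∷ 191966 ▸ 141956 ▸ 241976 ▸ 132164 ▸ 242576 ▸ 181673 ▸ 301976 ▸
  252467 ▸ 251867 ▸ 192467 ▸ 142457 ▸ 132665 ▸ 182174 ▸ 82655 ▸ 182774 ▸ 231683 ▸ 82154 ▸
  182273 ▸ 131663 ▸ 102035 ▸ 242273 ▸ 162035 ▸ 232184 ▸ 241772 ▸ 182675 ▸ 181772 ▸ 231964 ▸
  201653 ▸ 222156 ▸ 221853 ▸ 211764 ▸ 162756 ▸ 191845 ▸ 231645 ▸ 221875 ▸ 162156 ▸ 171865 ▸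
  221534 ▸ 212067 ▸ 152364 ▸ 172465 ▸ 241453 ▸ 161534 ▸ 172245 ▸ 232465 ▸ 211544 ▸ 182037 ▸
  162134 ▸ 162453 ▸ 222354 ▸ 221655 ▸ 231463 ▸ 192148 ▸ 182053 ▸ 212144 ▸ 152645 ▸ 232146 ▸
  271863 ▸ 162255 ▸ 201972 ▸ 152144 ▸ 142837 ▸ 182136 ▸ 261774 ▸ 161655 ▸ 152463 ▸ 132263 ▸
  142336 ▸ 161936 ▸ 192346 ▸ 191944 ▸ 281655 ▸ 151863 ▸ 172344 ▸ 142374 ▸ 201736 ▸ 221936 ▸
  182257 ▸ 251944 ▸ 122455 ▸ 221336 ▸ 241657 ▸ 201954 ▸ 251344 ▸ 121855 ▸ 181855 ▸ 191647 ▸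
  151964 ▸ 202453 ▸ 171845 ▸ 241855 ▸ 142156 ▸ 201853 ▸ 171346 ▸ 261736 ▸ 171946 ▸ 142453 ▸
  261136 ▸ 152245 ▸ 211645 ▸ 162053 ▸ 162154 ▸ stuck 161554 ∷ []) ∷ 261455 ▸ 211445 ▸ 261554 ▸
  241574 ▸ 152045 ▸ 202154 ▸ 211544 ▸ 242075 ▸ 211946 ▸ 201653 ▸ 182075 ▸ 212546 ▸ 161936 ▸
  162536 ▸ 162035 ▸ 222035 ▸ split 162134 (162635 ▸ 161534 ▸ 221534 ▸ 151445 ▸ 92045 ▸
  200954 ▸ 92546 ▸ 201554 ▸ 102635 ▸ 251564 ▸ 112427 ▸ 162437 ▸ 172245 ▸ 231645 ▸ 171645 ▸
  241453 ▸ stuck 181453 ∷ 212144 ▸ 221936 ▸ 222536 ▸ 271946 ▸ 212447 ▸ 252065 ▸ 162437 ▸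
  251465 ▸ 172245 ▸ 251966 ▸ 241673 ▸ 162156 ▸ 182356 ▸ 222255 ▸ 152364 ▸ 212166 ▸ 221754 ▸
  211764 ▸ 231865 ▸ 171744 ▸ 221556 ▸ 191845 ▸ 231364 ▸ 241475 ▸ 182037 ▸ 181855 ▸ 191465 ▸
  181475 ▸ 192126 ▸ 192148 ▸ 241855 ▸ 191663 ▸ 141455 ▸ 250865 ▸ 201356 ▸ 241635 ▸ 191647 ▸
  232047 ▸ 221974 ▸ 181574 ▸ 251366 ▸ 201857 ▸ 231827 ▸ 242136 ▸ 161974 ▸ 161655 ▸ 221738 ▸
  192146 ▸ 171766 ▸ 151863 ▸ 271247 ▸ 142156 ▸ 211263 ▸ 221756 ▸ 221374 ▸ 211863 ▸ 211964 ▸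
  161374 ▸ 151964 ▸ stuck 211364 ∷ 212144 ▸ 161534 ▸ 152144 ▸ 221936 ▸ 271544 ▸ 262154 ▸
  151445 ▸ 221534 ▸ 172025 ▸ 271946 ▸ 251663 ▸ 252065 ▸ 151946 ▸ 251465 ▸ 152447 ▸ 271346 ▸
  251966 ▸ 241673 ▸ 221837 ▸ 241855 ▸ 242273 ▸ 172328 ▸ 232047 ▸ 231744 ▸ 182136 ▸ 172344 ▸
  192247 ▸ 172047 ▸ 231645 ▸ 191944 ▸ 162255 ▸ 222354 ▸ 251647 ▸ 172245 ▸ 221853 ▸ 251944 ▸
  152166 ▸ 221754 ▸ 182053 ▸ 271863 ▸ 202156 ▸ 132544 ▸ 271263 ▸ 252146 ▸ 152463 ▸ 211863 ▸
  251344 ▸ 201954 ▸ 241536 ▸ 261954 ▸ 202453 ▸ 192045 ▸ 261354 ▸ 201853 ▸ stuck 201354 ∷ []) ∷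
 []) ∷ 251465 ▸ 142556 ▸ 251966 ▸ 252065 ▸ 192566 ▸ 251564 ▸ 252566 ▸ 202556 ▸ split 241475 (
  191465 ▸ 301475 ▸ 191966 ▸ 201554 ▸ 242075 ▸ 241976 ▸ 152045 ▸ 261554 ▸ 261956 ▸ 182075 ▸
  242576 ▸ 152546 ▸ 241673 ▸ 182675 ▸ 211946 ▸ 232184 ▸ 231865 ▸ 212546 ▸ 271946 ▸ 232465 ▸
  262154 ▸ stuck 242273 ∷ 182075 ▸ stuck 242075 ∷ 261356 ▸ 261956 ▸ 242075 ▸ 301475 ▸ 321356 ▸
  stuck 311564 ∷ []) ∷ []) ∷ 212045 ▸ split 202154 (142154 ▸ 252164 ▸ 191663 ▸ 251564 ▸
  split 211946 (192065 ▸ 251465 ▸ 252065 ▸ 251966 ▸ 202556 ▸ 261956 ▸ 152546 ▸ 212447 ▸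
  262556 ▸ 242075 ▸ 212546 ▸ 152447 ▸ 301475 ▸ 162536 ▸ 202457 ▸ 153047 ▸ 262457 ▸ 252467 ▸
  213047 ▸ 203057 ▸ 252566 ▸ 272447 ▸ 321956 ▸ 321356 ▸ 302075 ▸ 271847 ▸ 271346 ▸ 301574 ▸
  261554 ▸ 241673 ▸ 211544 ▸ 262154 ▸ 182273 ▸ 152144 ▸ 262655 ▸ 242273 ▸ 132263 ▸ 152645 ▸
  212144 ▸ 152045 ▸ 192263 ▸ 201554 ▸ 142754 ▸ 241772 ▸ 181673 ▸ 251063 ▸ 231964 ▸ 132164 ▸
  191762 ▸ 231683 ▸ 222156 ▸ 221853 ▸ 142253 ▸ 131663 ▸ 182174 ▸ 181954 ▸ 222354 ▸ 141752 ▸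
  162255 ▸ 231463 ▸ 182455 ▸ 201873 ▸ 172063 ▸ 142336 ▸ 172366 ▸ 212265 ▸ 172344 ▸ 151863 ▸
  172564 ▸ 192346 ▸ 192247 ▸ 211764 ▸ 262275 ▸ 152425 ▸ 152463 ▸ 202435 ▸ 242356 ▸ 221875 ▸
  261774 ▸ 201934 ▸ 252445 ▸ 192445 ▸ 241855 ▸ 221374 ▸ 281655 ▸ 251944 ▸ 182356 ▸ 241255 ▸
  142936 ▸ 242455 ▸ 201954 ▸ 181855 ▸ 202275 ▸ 202936 ▸ 252544 ▸ 251445 ▸ 202453 ▸ 201774 ▸
  191966 ▸ 212067 ▸ 212083 ▸ 222855 ▸ 211566 ▸ 141774 ▸ 211847 ▸ 272067 ▸ 162574 ▸ 222356 ▸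
  242736 ▸ 232663 ▸ 261556 ▸ 212065 ▸ 191764 ▸ 231766 ▸ 271566 ▸ 212564 ▸ 242237 ▸ 232164 ▸
  162075 ▸ 251647 ▸ 232445 ▸ 252045 ▸ 182673 ▸ 181956 ▸ 202156 ▸ 231946 ▸ 241356 ▸ 192364 ▸
  231447 ▸ 191865 ▸ 291447 ▸ 192465 ▸ stuck 241956 ∷ 212546 ▸ 261455 ▸ 162536 ▸ 152546 ▸
  261956 ▸ 211445 ▸ 251663 ▸ 142754 ▸ 202556 ▸ 153146 ▸ 191564 ▸ 271445 ▸ 201653 ▸ 192263 ▸
  143255 ▸ 252065 ▸ 201356 ▸ 241574 ▸ 261356 ▸ 221936 ▸ 152144 ▸ 132263 ▸ 192065 ▸ 271946 ▸
  251465 ▸ 152645 ▸ 242075 ▸ 222437 ▸ 321455 ▸ 251966 ▸ 103136 ▸ 152045 ▸ 311366 ▸ 241855 ▸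
  142253 ▸ 132164 ▸ 251366 ▸ 182455 ▸ 191845 ▸ 231744 ▸ 242356 ▸ 261774 ▸ 141956 ▸ 191966 ▸
  172344 ▸ 231964 ▸ 132445 ▸ 232245 ▸ 192346 ▸ 142556 ▸ 181855 ▸ 192566 ▸ 252566 ▸ 192445 ▸
  212265 ▸ 162437 ▸ 171744 ▸ 172647 ▸ 242455 ▸ 172564 ▸ 182736 ▸ 162255 ▸ 161936 ▸ 172245 ▸
  232344 ▸ 123055 ▸ 242136 ▸ 162855 ▸ 221655 ▸ 182136 ▸ 152463 ▸ 182174 ▸ 102536 ▸ 122736 ▸
  172944 ▸ 122455 ▸ 132863 ▸ 152744 ▸ 241536 ▸ 182774 ▸ 82655 ▸ 132544 ▸ 122136 ▸ 153063 ▸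
  122774 ▸ 212144 ▸ 181536 ▸ 172663 ▸ 83255 ▸ 132247 ▸ 122174 ▸ 232025 ▸ 132746 ▸ 172164 ▸
  182035 ▸ 182237 ▸ 162356 ▸ 182534 ▸ 152564 ▸ stuck 172445 ∷ 212546 ▸ 151946 ▸ 162536 ▸
  stuck 152447 ∷ []) ∷ 152645 ▸ 252164 ▸ 152144 ▸ split 311465 (251465 ▸ 192065 ▸ 251966 ▸
  192665 ▸ stuck 242174 ∷ 261956 ▸ 202556 ▸ 212645 ▸ stuck 192764 ∷ 261455 ▸ 261956 ▸ 251663 ▸
  202556 ▸ 191663 ▸ 201653 ▸ 252065 ▸ 142154 ▸ 251564 ▸ 92645 ▸ 141653 ▸ 201554 ▸ 311564 ▸
  312065 ▸ 261554 ▸ 262556 ▸ 241673 ▸ 211544 ▸ 212546 ▸ 301673 ▸ 162035 ▸ 162536 ▸ 301073 ▸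
  102635 ▸ 152744 ▸ 112526 ▸ 301574 ▸ 152243 ▸ split 192445 (191845 ▸ 211764 ▸ 132445 ▸
  142253 ▸ 142754 ▸ 162635 ▸ 192263 ▸ 103235 ▸ 132263 ▸ 192764 ▸ 191762 ▸ 113027 ▸ 211643 ▸
  242273 ▸ 181673 ▸ 163037 ▸ 151643 ▸ 182273 ▸ 262154 ▸ 241772 ▸ 213047 ▸ 262655 ▸ 231683 ▸
  212447 ▸ 252566 ▸ 221875 ▸ 232283 ▸ 152447 ▸ 302075 ▸ 242075 ▸ 202457 ▸ 151946 ▸ 231964 ▸
  301475 ▸ 161754 ▸ 241756 ▸ 222156 ▸ 172564 ▸ 232465 ▸ 361475 ▸ 171865 ▸ 251867 ▸ 182356 ▸
  242257 ▸ 222354 ▸ 311966 ▸ 221374 ▸ 172366 ▸ 261675 ▸ 252467 ▸ 162475 ▸ 251966 ▸ 192247 ▸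
  192467 ▸ 142556 ▸ 241855 ▸ 261774 ▸ 212166 ▸ 191966 ▸ 202275 ▸ 122637 ▸ 182455 ▸ 211566 ▸
  211847 ▸ 152766 ▸ 172146 ▸ 172647 ▸ 242455 ▸ 271566 ▸ 271847 ▸ 162574 ▸ 162855 ▸ 232146 ▸
  232047 ▸ 212065 ▸ 222574 ▸ 182736 ▸ 232647 ▸ 162075 ▸ 212564 ▸ 242136 ▸ 292047 ▸ 222855 ▸
  222356 ▸ 222075 ▸ 192645 ▸ 291447 ▸ 272346 ▸ 212346 ▸ 241956 ▸ 182556 ▸ 192465 ▸ 202475 ▸
  stuck 252465 ∷ 202253 ▸ 202754 ▸ 142754 ▸ 262154 ▸ 252263 ▸ 162635 ▸ 192263 ▸ 262655 ▸
  192863 ▸ 212144 ▸ 252566 ▸ 212744 ▸ 212645 ▸ 242455 ▸ 163136 ▸ stuck 222536 ∷ 202253 ▸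
  212364 ▸ 261653 ▸ 211764 ▸ 251845 ▸ 191845 ▸ 271764 ▸ 132445 ▸ 291683 ▸ 142556 ▸ 231683 ▸
  192065 ▸ 241772 ▸ 242075 ▸ stuck 231964 ∷ []) ∷ 251465 ▸ 261956 ▸ 261455 ▸ 192065 ▸ 251966 ▸
  202556 ▸ 251663 ▸ 211946 ▸ 242075 ▸ 201653 ▸ 151946 ▸ 212447 ▸ 202253 ▸ 152447 ▸ 202457 ▸
  201857 ▸ split 192467 (251867 ▸ 252467 ▸ 142457 ▸ 262556 ▸ 203156 ▸ 312065 ▸ 153146 ▸
  252065 ▸ 143057 ▸ 251564 ▸ 162938 ▸ 162437 ▸ 182356 ▸ 241756 ▸ 242356 ▸ 261675 ▸ stuck 262275
  ∷ 191966 ▸ 211847 ▸ 211346 ▸ 151847 ▸ 201554 ▸ 161936 ▸ 261554 ▸ 162437 ▸ 241673 ▸ 211544 ▸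
  182356 ▸ 192445 ▸ 172245 ▸ 181855 ▸ 172564 ▸ 231865 ▸ 191944 ▸ 231964 ▸ 221754 ▸ 232366 ▸
  222156 ▸ 251845 ▸ 271764 ▸ 202237 ▸ 251344 ▸ 261653 ▸ 222255 ▸ 192148 ▸ 192126 ▸ 262154 ▸
  262253 ▸ 221655 ▸ 242174 ▸ 241657 ▸ 242136 ▸ 321554 ▸ 272045 ▸ 201736 ▸ 211863 ▸ 252263 ▸
  221738 ▸ 271544 ▸ 222035 ▸ 191647 ▸ 212463 ▸ 242455 ▸ 231827 ▸ 192146 ▸ 232344 ▸ 222574 ▸
  281336 ▸ 192645 ▸ 281974 ▸ 231845 ▸ 221974 ▸ 271863 ▸ 211964 ▸ 161974 ▸ 251944 ▸ 212564 ▸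
  162473 ▸ 201954 ▸ 271964 ▸ 221873 ▸ stuck 271364 ∷ 191966 ▸ 252467 ▸ 251366 ▸ 191465 ▸
  211847 ▸ 192566 ▸ 251867 ▸ 262556 ▸ 241574 ▸ 211346 ▸ 201554 ▸ 202358 ▸ 212546 ▸ 261554 ▸
  162536 ▸ 271346 ▸ 241673 ▸ 211544 ▸ 221837 ▸ 181673 ▸ 221655 ▸ 172328 ▸ 231766 ▸ 201736 ▸
  192247 ▸ 241756 ▸ 202336 ▸ 182136 ▸ 212166 ▸ 172366 ▸ 182356 ▸ 241536 ▸ 211566 ▸ 182455 ▸
  171865 ▸ 221875 ▸ 202275 ▸ 192544 ▸ 231865 ▸ 221374 ▸ 152766 ▸ 192045 ▸ 251746 ▸ 281374 ▸
  162574 ▸ 191546 ▸ 261857 ▸ 271566 ▸ 221974 ▸ 212065 ▸ 261356 ▸ 211465 ▸ 260855 ▸ 271465 ▸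
  stuck 270966 ∷ []) ∷ []) ∷ 152645 ▸ 261554 ▸ 152144 ▸ 201554 ▸ 211544 ▸ 251564 ▸ 151544 ▸
  152045 ▸ split 152744 (212144 ▸ 202253 ▸ 262154 ▸ stuck 202754 ∷ 162536 ▸ 162035 ▸ 102035 ▸
  102536 ▸ 92744 ▸ 152546 ▸ 161936 ▸ 221936 ▸ 161435 ▸ 271445 ▸ 212144 ▸ 211445 ▸ 221435 ▸
  191564 ▸ 211946 ▸ 201653 ▸ 211643 ▸ 250964 ▸ 151946 ▸ 202253 ▸ 151643 ▸ 251465 ▸ 211346 ▸
  142253 ▸ 241673 ▸ 191465 ▸ 191762 ▸ 221754 ▸ 181673 ▸ stuck 161754 ∷ []) ∷ []) ∷ []) ∷ [])

triangle-with-pair : ∀ c → Triangle c → colour c (lattice 1 2) ≡ colour c (lattice 0 1) →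
  MonoEdge c
triangle-with-pair = refute-triangle-with-pair triangleTree tt

thirdTurn-colour : ∀ c m n m′ → m′ ℕ.+ m ℕ.+ n ≡ 3 →
  colour (move thirdTurn c) (lattice m n) ≡ colour c (lattice m′ m)
thirdTurn-colour c m n m′ e =
  move-colour thirdTurn c (lattice m n) (lattice m′ m) (thirdTurn-lattice m n m′ e)

thirdTurn-triangle : ∀ c → Triangle c → Triangle (move thirdTurn c)
thirdTurn-triangle c (t₁ , t₂) =
    trans (thirdTurn-colour c 2 1 0 refl) (trans t₂ (sym (thirdTurn-colour c 0 2 1 refl)))
  , trans (thirdTurn-colour c 0 2 1 refl)
      (trans (sym (trans t₁ t₂)) (sym (thirdTurn-colour c 1 0 2 refl)))

-- The third turn carries the pair of `triangle-with-pair` to this one and permutes the vertices of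
-- the triangle; a second application gives the last pair.
triangle-with-pair′ : ∀ c → Triangle c → colour c (lattice 0 1) ≡ colour c (lattice 2 0) →
  MonoEdge c
triangle-with-pair′ c t e = MonoEdge-move thirdTurn {c}
  (triangle-with-pair (move thirdTurn c) (thirdTurn-triangle c t)
    (trans (thirdTurn-colour c 1 2 0 refl) (trans e (sym (thirdTurn-colour c 0 1 2 refl)))))

triangle-with-pair″ : ∀ c → Triangle c → colour c (lattice 2 0) ≡ colour c (lattice 1 2) →
  MonoEdge c
triangle-with-pair″ c t e = MonoEdge-move thirdTurn {c}
  (triangle-with-pair′ (move thirdTurn c) (thirdTurn-triangle c t)
    (trans (thirdTurn-colour c 0 1 2 refl) (trans e (sym (thirdTurn-colour c 2 0 1 refl)))))

-- Evaluated on all 4⁵ tuples. In the application `x` and `y` are the colours of the centre and of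
-- the triangle, and `p`, `q`, `r` those of the other hexagon vertices.
pigeonhole : (x y p q r : Fin 4) → x ≡ y ⊎ (p ≡ x ⊎ q ≡ x ⊎ r ≡ x) ⊎ (p ≡ y ⊎ q ≡ y ⊎ r ≡ y)
  ⊎ (p ≡ q ⊎ q ≡ r ⊎ r ≡ p)
pigeonhole = toWitness {a? = all? λ x → all? λ y → all? λ p → all? λ q → all? λ r →
  (x ≟ y) ⊎-dec (((p ≟ x) ⊎-dec ((q ≟ x) ⊎-dec (r ≟ x))) ⊎-dec
  (((p ≟ y) ⊎-dec ((q ≟ y) ⊎-dec (r ≟ y))) ⊎-dec ((p ≟ q) ⊎-dec ((q ≟ r) ⊎-dec (r ≟ p)))))} _

-- Unless there is an edge, the other three hexagon vertices avoid the colours of the centre and of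
-- the triangle, so two of them share one of the two remaining colours. The three possible pairs are
-- the three preceding cases.
triangle : ∀ c → Triangle c → MonoEdge c
triangle c t@(t₁ , t₂) =
  [ lattice-edge c 1 1 2 1 refl
  , [ [ lattice-edge c 1 2 1 1 refl
      , [ lattice-edge c 0 1 1 1 refl , lattice-edge c 2 0 1 1 refl ]′ ]′
  , [ [ lattice-edge c 1 2 2 1 refl
      , [ (λ e → lattice-edge c 0 1 0 2 refl (trans e t₁))
        , (λ e → lattice-edge c 2 0 1 0 refl (trans e (trans t₁ t₂))) ]′ ]′
  , [ triangle-with-pair c t , [ triangle-with-pair′ c t , triangle-with-pair″ c t ]′ ]′ ]′ ]′ ]′
  (pigeonhole (colour c (lattice 1 1)) (colour c (lattice 2 1))
    (colour c (lattice 1 2)) (colour c (lattice 0 1)) (colour c (lattice 2 0)))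

-- The triangular lattice

Site : Set
Site = ℕ × ℕ

at : Colouring 4 → Site → Fin 4
at c (i , j) = colour c (lattice i j)

upTriangle : ∀ c i j → at c (2 ℕ.+ i , 1 ℕ.+ j) ≡ at c (i , 2 ℕ.+ j) →
  at c (i , 2 ℕ.+ j) ≡ at c (1 ℕ.+ i , j) → MonoEdge c
upTriangle c i j t₁ t₂ = MonoEdge-move m {c} (triangle (move m c)
  ( trans (moved 2 1) (trans t₁ (sym (moved 0 2)))
  , trans (moved 0 2) (trans t₂ (sym (moved 1 0)))))
  where
  m = translation (lattice i j)
  moved : ∀ k l → colour (move m c) (lattice k l) ≡ at c (k ℕ.+ i , l ℕ.+ j)
  moved k l = move-colour m c (lattice k l) (lattice (k ℕ.+ i) (l ℕ.+ j))
    (translate-lattice k l i j)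

-- A half turn carries the triangle of `Triangle` to the other kind of triangle inscribed in a
-- hexagon; its constant term also accounts for the shift by (i , j).
downTriangle : ∀ c i j → at c (1 ℕ.+ i , 2 ℕ.+ j) ≡ at c (i , 1 ℕ.+ j) →
  at c (i , 1 ℕ.+ j) ≡ at c (2 ℕ.+ i , j) → MonoEdge c
downTriangle c i j t₁ t₂ = MonoEdge-move m {c} (triangle (move m c)
  ( trans (moved 2 1 0 1 refl refl) (trans t₂ (sym (moved 0 2 2 0 refl refl)))
  , trans (moved 0 2 2 0 refl refl) (trans (sym (trans t₁ t₂)) (sym (moved 1 0 1 2 refl refl)))))
  where
  m = halfTurn (lattice (2 ℕ.+ i) (2 ℕ.+ j))
  moved : ∀ k l k′ l′ → k ℕ.+ k′ ≡ 2 → l ℕ.+ l′ ≡ 2 →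
    colour (move m c) (lattice k l) ≡ at c (k′ ℕ.+ i , l′ ℕ.+ j)
  moved k l k′ l′ ek el = move-colour m c (lattice k l) (lattice (k′ ℕ.+ i) (l′ ℕ.+ j))
    (subst₂ (λ s t → act (halfTurn (lattice (s ℕ.+ i) (t ℕ.+ j))) (lattice k l) ≋²
        lattice (k′ ℕ.+ i) (l′ ℕ.+ j)) ek el
      (halfTurn-lattice k l k′ l′ i j))

-- The constraints on the colours of the hexagon with centre (1 + i , 1 + j):
-- sets of sites that do not all have the same colour.
hexagon : Site → List (List Site)
hexagon (i , j) =
  (o ∷ p₀ ∷ []) ∷ (o ∷ p₁ ∷ []) ∷ (o ∷ p₂ ∷ []) ∷
  (o ∷ p₃ ∷ []) ∷ (o ∷ p₄ ∷ []) ∷ (o ∷ p₅ ∷ []) ∷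
  (p₀ ∷ p₁ ∷ []) ∷ (p₁ ∷ p₂ ∷ []) ∷ (p₂ ∷ p₃ ∷ []) ∷
  (p₃ ∷ p₄ ∷ []) ∷ (p₄ ∷ p₅ ∷ []) ∷ (p₅ ∷ p₀ ∷ []) ∷
  (p₀ ∷ p₂ ∷ p₄ ∷ []) ∷ (p₁ ∷ p₃ ∷ p₅ ∷ []) ∷ []
  where
  o  = 1 ℕ.+ i , 1 ℕ.+ j
  p₀ = 2 ℕ.+ i , 1 ℕ.+ j
  p₁ = 1 ℕ.+ i , 2 ℕ.+ j
  p₂ = i , 2 ℕ.+ j
  p₃ = i , 1 ℕ.+ j
  p₄ = 1 ℕ.+ i , j
  p₅ = 2 ℕ.+ i , j

Mono : Colouring 4 → List Site → Set
Mono c g = ∃ λ x → All (λ w → at c w ≡ x) g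

mono-pair : ∀ {c u v} → Mono c (u ∷ v ∷ []) → at c u ≡ at c v
mono-pair (_ , e ∷ f ∷ []) = trans e (sym f)

hexagon-sound : ∀ c s → All (λ g → Mono c g → MonoEdge c) (hexagon s)
hexagon-sound c (i , j) =
  edge 1 1 2 1 refl ∷ edge 1 1 1 2 refl ∷ edge 1 1 0 2 refl ∷
  edge 1 1 0 1 refl ∷ edge 1 1 1 0 refl ∷ edge 1 1 2 0 refl ∷
  edge 2 1 1 2 refl ∷ edge 1 2 0 2 refl ∷ edge 0 2 0 1 refl ∷
  edge 0 1 1 0 refl ∷ edge 1 0 2 0 refl ∷ edge 2 0 2 1 refl ∷
  (λ { (_ , e ∷ f ∷ g ∷ []) → upTriangle c i j (trans e (sym f)) (trans f (sym g)) }) ∷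
  (λ { (_ , e ∷ f ∷ g ∷ []) → downTriangle c i j (trans e (sym f)) (trans f (sym g)) }) ∷ []
  where
  -- The shift (i , j) cancels in the differences, so the distance condition is a closed
  -- computation.
  edge : ∀ m n m′ n′ → norm² (ι m ℚ.- ι m′) (ι n ℚ.- ι n′) ≡ 1ℚ →
    Mono c ((m ℕ.+ i , n ℕ.+ j) ∷ (m′ ℕ.+ i , n′ ℕ.+ j) ∷ []) → MonoEdge c
  edge m n m′ n′ e mono = lattice-edge c (m ℕ.+ i) (n ℕ.+ j) (m′ ℕ.+ i) (n′ ℕ.+ j)
    (trans (cong₂ norm² (ι-+-cancel m m′ i) (ι-+-cancel n n′ j)) e)
    (mono-pair {c} {m ℕ.+ i , n ℕ.+ j} {m′ ℕ.+ i , n′ ℕ.+ j} mono)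

-- The 13 hexagons whose centres are at distance at most √3 from (3 , 3).
hexagons : List Site
hexagons = (2 , 2) ∷ (3 , 2) ∷ (2 , 3) ∷ (1 , 3) ∷ (1 , 2) ∷ (2 , 1) ∷ (3 , 1) ∷
  (3 , 3) ∷ (1 , 4) ∷ (0 , 3) ∷ (1 , 1) ∷ (3 , 0) ∷ (4 , 1) ∷ []

_≟ₛ_ : DecidableEquality Site
_≟ₛ_ = ≡-dec ℕ._≟_ ℕ._≟_

open DecMembership _≟ₛ_ using (_∈?_)

-- The `bad` predicate for the lattice: some forbidden group, of two or of three sites, lies inside
-- the class once `v` has joined it.
completes : List (List Site) → Site → List Site → Bool
completes groups v ws = any (all (λ w → ⌊ w ∈? (v ∷ ws) ⌋)) groups

completes-sound : ∀ {R : Set} c groups → All (λ g → Mono c g → R) groups →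
  ∀ v ws → T (completes groups v ws) → All (λ w → at c w ≡ at c v) ws → R
completes-sound c groups hyp v ws done same =
  let member = λ w → ⌊ w ∈? (v ∷ ws) ⌋
      i = any⁻ (all member) groups done
      mono⇒R , covered = All.lookupAny hyp i
  in mono⇒R (at c v ,
       All.map (λ {w} w∈ → All.lookup (refl ∷ same) (toWitness {a? = w ∈? (v ∷ ws)} w∈))
         (all⁺ member (Any.lookup i) covered))

site : ℕ → Site
site n = n ℕ./ 10 , n ℕ.% 10

constraints : List (List Site) → List (List Site)
constraints extra = extra ++ concatMap hexagon hexagons

-- A unit triangle at the centre (3 , 3) has three different colours unless it contains an edge;
-- naming them removes the colour symmetry.
patchClasses : Classes Site
patchClasses = ((3 , 3) ∷ []) ∷ ((4 , 3) ∷ []) ∷ ((3 , 4) ∷ []) ∷ [] ∷ []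

-- The `extra` groups encode the negation of what is to be shown: if one of them is monochromatic,
-- the conclusion `R` follows.
refute-patch : ∀ {R : Set} c extra → (MonoEdge c → R) → All (λ g → Mono c g → R) extra → ∀ t →
  T (check site (completes (constraints extra)) patchClasses t) → R
refute-patch c extra edge hyp t =
  refute site (completes (constraints extra)) (at c)
    (completes-sound c (constraints extra)
      (++⁺ hyp (concat⁺ (map⁺
        (All.universal (λ s → All.map (λ h m → edge (h m)) (hexagon-sound c s)) hexagons)))))
    (at c (3 , 3)) (at c (4 , 3)) (at c (3 , 4)) t (refl ∷ []) (refl ∷ []) (refl ∷ [])
    (λ e → edge (lattice-edge c 3 3 4 3 refl e))
    (λ e → edge (lattice-edge c 3 3 3 4 refl e))
    (λ e → edge (lattice-edge c 4 3 3 4 refl e))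

-- Opposite points at distance 2 from the centre

Both Either : Colouring 4 → Site → Site → Set
Both c u v = at c u ≡ at c (3 , 3) × at c v ≡ at c (3 , 3)
Either c u v = at c u ≡ at c (3 , 3) ⊎ at c v ≡ at c (3 , 3)

-- These trees were found by computer search, too.
bothTree : Tree
bothTree =
  split 24 (split 35 (split 32 (23 ▸ 42 ▸ 31 ▸ 22 ▸ stuck 41 ∷ 23 ▸ stuck 42 ∷ []) ∷ 44 ▸
  stuck 25 ∷ []) ∷ split 23 (split 32 (42 ▸ split 22 (41 ▸ 31 ▸ 14 ▸ 13 ▸ split 51 (15 ▸
  5 ▸ stuck 4 ∷ 50 ▸ stuck 40 ∷ []) ∷ split 13 (14 ▸ split 53 (52 ▸ 41 ▸ 31 ▸ 44 ▸ 35 ▸ 45 ▸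
  stuck 54 ∷ 44 ▸ 52 ▸ 25 ▸ 15 ▸ 51 ▸ 61 ▸ stuck 62 ∷ []) ∷ 14 ▸ 25 ▸ 15 ▸ split 35 (31 ▸ 21 ▸
  stuck 12 ∷ 16 ▸ stuck 26 ∷ []) ∷ []) ∷ []) ∷ 42 ▸ split 13 (53 ▸ 52 ▸ stuck 44 ∷ 22 ▸
  stuck 14 ∷ []) ∷ []) ∷ 42 ▸ 32 ▸ split 51 (15 ▸ 14 ▸ stuck 25 ∷ 52 ▸ stuck 41 ∷ []) ∷ []) ∷
 [])

either₀Tree : Tree
either₀Tree =
  split 53 (42 ▸ 52 ▸ split 51 (41 ▸ stuck 32 ∷ 41 ▸ 32 ▸ split 13 (23 ▸ 31 ▸ stuck 22 ∷
  23 ▸ 22 ▸ 31 ▸ 50 ▸ stuck 40 ∷ []) ∷ []) ∷ 44 ▸ split 25 (35 ▸ 24 ▸ split 15 (split 14 (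
  13 ▸ stuck 23 ∷ 13 ▸ stuck 23 ∷ []) ∷ 26 ▸ stuck 16 ∷ []) ∷ 35 ▸ stuck 24 ∷ []) ∷ [])

either₁Tree : Tree
either₁Tree =
  split 44 (split 52 (53 ▸ 42 ▸ split 51 (split 41 (32 ▸ 31 ▸ 23 ▸ 22 ▸ 24 ▸ 14 ▸ stuck 13
  ∷ 32 ▸ 31 ▸ 24 ▸ 23 ▸ 22 ▸ 14 ▸ stuck 13 ∷ []) ∷ 61 ▸ stuck 62 ∷ []) ∷ 53 ▸ stuck 42 ∷ []) ∷
  35 ▸ 24 ▸ 25 ▸ split 53 (split 15 (14 ▸ 23 ▸ 13 ▸ 4 ▸ stuck 5 ∷ 14 ▸ stuck 23 ∷ []) ∷ 45 ▸
  stuck 54 ∷ []) ∷ [])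

either₂Tree : Tree
either₂Tree =
  split 24 (split 35 (25 ▸ 15 ▸ 44 ▸ 23 ▸ 14 ▸ 32 ▸ 22 ▸ 13 ▸ 53 ▸ 42 ▸ 31 ▸ 41 ▸ 52 ▸
  stuck 51 ∷ 25 ▸ stuck 44 ∷ []) ∷ split 15 (25 ▸ 44 ▸ 35 ▸ 14 ▸ 23 ▸ split 54 (45 ▸ stuck 53
  ∷ 53 ▸ 13 ▸ 5 ▸ stuck 4 ∷ []) ∷ 23 ▸ 14 ▸ split 22 (13 ▸ stuck 32 ∷ 13 ▸ 32 ▸ 42 ▸
  split 41 (31 ▸ 21 ▸ stuck 12 ∷ 51 ▸ 52 ▸ 44 ▸ stuck 53 ∷ []) ∷ []) ∷ []) ∷ [])

-- With all three pairs forbidden to agree with the centre, `bothTree` leaves no colouring of the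
-- patch.
both : ∀ c → MonoEdge c ⊎
  Both c (5 , 3) (1 , 3) ⊎ Both c (3 , 5) (3 , 1) ⊎ Both c (1 , 5) (5 , 1)
both c = refute-patch c
  (((3 , 3) ∷ (5 , 3) ∷ (1 , 3) ∷ []) ∷ ((3 , 3) ∷ (3 , 5) ∷ (3 , 1) ∷ []) ∷
    ((3 , 3) ∷ (1 , 5) ∷ (5 , 1) ∷ []) ∷ [])
  inj₁
  ( (λ { (_ , e ∷ f ∷ g ∷ []) → inj₂ (inj₁ (trans f (sym e) , trans g (sym e))) })
  ∷ (λ { (_ , e ∷ f ∷ g ∷ []) → inj₂ (inj₂ (inj₁ (trans f (sym e) , trans g (sym e)))) })
  ∷ (λ { (_ , e ∷ f ∷ g ∷ []) → inj₂ (inj₂ (inj₂ (trans f (sym e) , trans g (sym e)))) }) ∷ [])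
  bothTree tt

-- The negation of the alternatives of `either` other than an edge.
eitherConstraints : Site → Site → List (List Site)
eitherConstraints u v =
  ((5 , 3) ∷ (1 , 3) ∷ []) ∷ (u ∷ (3 , 3) ∷ []) ∷ (v ∷ (3 , 3) ∷ []) ∷ []

either : ∀ c u v t →
  T (check site (completes (constraints (eitherConstraints u v))) patchClasses t) →
  MonoEdge c ⊎ at c (5 , 3) ≡ at c (1 , 3) ⊎ Either c u v
either c u v = refute-patch c (eitherConstraints u v) inj₁
  ( (λ m → inj₂ (inj₁ (mono-pair {c} {5 , 3} {1 , 3} m)))
  ∷ (λ m → inj₂ (inj₂ (inj₁ (mono-pair {c} {u} {3 , 3} m))))
  ∷ (λ m → inj₂ (inj₂ (inj₂ (mono-pair {c} {v} {3 , 3} m)))) ∷ [])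

-- cos θ = 7/8, so that points at distance 2 from the centre move by 1.
opposite-same : ∀ c → MonoEdge c ⊎ at c (5 , 3) ≡ at c (1 , 3)
opposite-same c =
  [ (λ m → inj₁ (MonoEdge-move ρ {c} m))
  , [ clash 5 3 1 3 refl refl (either c (5 , 3) (1 , 3) either₀Tree tt)
  , [ clash 3 5 3 1 refl refl (either c (3 , 5) (3 , 1) either₁Tree tt)
    , clash 1 5 5 1 refl refl (either c (1 , 5) (5 , 1) either₂Tree tt) ]′ ]′ ]′
  (both (move ρ c))
  where
  7/8 : ℚ
  7/8 = ℤ.+ 7 / 8
  0≤1-p² : 0ℚ ℚ.≤ 1ℚ ℚ.- 7/8 ℚ.* 7/8
  0≤1-p² = ℚ.nonNegative⁻¹ (1ℚ ℚ.- 7/8 ℚ.* 7/8)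
  ρ : Motion
  ρ = turn 7/8 0≤1-p² (lattice 3 3)
  centre : colour (move ρ c) (lattice 3 3) ≡ at c (3 , 3)
  centre = move-colour ρ c (lattice 3 3) (lattice 3 3) (turn-centre 7/8 0≤1-p² (lattice 3 3))
  step : ∀ i j → (1ℚ ℚ.- 7/8 ℚ.+ (1ℚ ℚ.- 7/8)) ℚ.* norm² (ι i ℚ.- ι 3) (ι j ℚ.- ι 3) ≡ 1ℚ →
    at c (i , j) ≡ at c (3 , 3) → at (move ρ c) (i , j) ≡ at (move ρ c) (3 , 3) → MonoEdge c
  step i j e s s′ = monoEdge c (lattice i j) (act ρ (lattice i j))
    (turn-dist² 7/8 0≤1-p² (lattice 3 3) (lattice i j) (norm² (ι i ℚ.- ι 3) (ι j ℚ.- ι 3))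
      (lattice-dist² i j 3 3) e)
    (trans s (sym (trans s′ centre)))
  -- Unless an alternative of the goal already holds, `either` gives a site of the pair coloured
  -- like the centre, and `Both` says the same of its turned image. The two are at distance 1, since
  -- 2 (1 - 7/8) · 4 = 1.
  clash : ∀ i j k l →
    (1ℚ ℚ.- 7/8 ℚ.+ (1ℚ ℚ.- 7/8)) ℚ.* norm² (ι i ℚ.- ι 3) (ι j ℚ.- ι 3) ≡ 1ℚ →
    (1ℚ ℚ.- 7/8 ℚ.+ (1ℚ ℚ.- 7/8)) ℚ.* norm² (ι k ℚ.- ι 3) (ι l ℚ.- ι 3) ≡ 1ℚ →
    MonoEdge c ⊎ at c (5 , 3) ≡ at c (1 , 3) ⊎ Either c (i , j) (k , l) →
    Both (move ρ c) (i , j) (k , l) → MonoEdge c ⊎ at c (5 , 3) ≡ at c (1 , 3)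
  clash i j k l e₁ e₂ (inj₁ m) _ = inj₁ m
  clash i j k l e₁ e₂ (inj₂ (inj₁ s)) _ = inj₂ s
  clash i j k l e₁ e₂ (inj₂ (inj₂ (inj₁ s))) (s′ , _) = inj₁ (step i j e₁ s s′)
  clash i j k l e₁ e₂ (inj₂ (inj₂ (inj₂ s))) (_ , s′) = inj₁ (step k l e₂ s s′)

-- cos θ = 31/32, so that points at distance 4 from the centre move by 1.
monoEdge-exists : ∀ c → MonoEdge c
monoEdge-exists c =
  [ (λ m → m)
  -- By `s` and `s′`, both (5 , 3) and its image have the colour of the fixed point (1 , 3); their
  -- squared distance is 2 (1 - 31/32) · 16 = 1.
  , (λ s → [ MonoEdge-move ρ {c}
           , (λ s′ → monoEdge c (lattice 5 3) (act ρ (lattice 5 3))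
               (turn-dist² 31/32 0≤1-p² (lattice 1 3) (lattice 5 3)
                 (norm² (ι 5 ℚ.- ι 1) (ι 3 ℚ.- ι 3)) (lattice-dist² 5 3 1 3) refl)
               (trans s (sym (trans s′ centre)))) ]′
           (opposite-same (move ρ c))) ]′
  (opposite-same c)
  where
  31/32 : ℚ
  31/32 = ℤ.+ 31 / 32
  0≤1-p² : 0ℚ ℚ.≤ 1ℚ ℚ.- 31/32 ℚ.* 31/32
  0≤1-p² = ℚ.nonNegative⁻¹ (1ℚ ℚ.- 31/32 ℚ.* 31/32)
  ρ : Motion
  ρ = turn 31/32 0≤1-p² (lattice 1 3)
  centre : colour (move ρ c) (lattice 1 3) ≡ at c (1 , 3)
  centre = move-colour ρ c (lattice 1 3) (lattice 1 3) (turn-centre 31/32 0≤1-p² (lattice 1 3))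

-- From unit pairs to the chromatic number

monochromatic-unit-pair : ∀ (c : Colouring 4) →
  ∃₂ λ (x y : ℝ²) → dist x y ≈ 1ℝ × colour c x ≡ colour c y
monochromatic-unit-pair c =
  let P , Q , e , same = monoEdge-exists c in P , Q , dist-unit P Q e , same

-- A colouring with `k` colours becomes a 4-colouring through the injection `inject≤`, which
-- reflects equality of colours.
¬4-colourable : ∀ k → k ≤ 4 → Colourable k → ⊥
¬4-colourable k k≤4 (c , proper) =
  let P , Q , e , same = monochromatic-unit-pair c₄
  in proper P Q e (inject≤-injective k≤4 k≤4 (colour c P) (colour c Q) same)
  where
  c₄ : Colouring 4
  c₄ = record
    { to   = λ P → inject≤ (colour c P) k≤4
    ; cong = λ e → cong (λ x → inject≤ x k≤4) (Func.cong c e)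
    }

mainTheorem1 : (∀ (χ : ℕ) → IsChromaticNumber χ → 5 ≤ χ) ×
    (∀ (c : Colouring 4) → ∃₂ λ (x y : ℝ²) → dist x y ≈ 1ℝ × colour c x ≡ colour c y)
mainTheorem1 =
    (λ χ (colourable , _) → ℕ.≰⇒> λ χ≤4 → ¬4-colourable χ χ≤4 colourable)
  , monochromatic-unit-pair
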